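{- Let $g_n$ be the number of strongly graded $(\mathbf{3+1})$-avoiding posets on the vertex set $[n]$, let $w_n$ be the number of weakly graded $(\mathbf{3+1})$-avoiding posets on $[n]$, and let $\psi_n=\sum_{i=0}^n \frac{2^{i(n-i)}}{i!\,(n-i)!}$. Then, as $n\to\infty$, $$g_n\sim w_n\sim n!\,\psi_n.$$
   Context: All posets are finite; a poset on $[n]=\{1,\dots,n\}$ is a partial order on this labeled set, and distinct order relations give distinct posets. A poset $P$ is weakly graded if there is a function $\operatorname{rk}:P\to\mathbb{N}$ such that $\operatorname{rk}(b)=\operatorname{rk}(a)+1$ whenever $b$ covers $a$, and such that the minimum value of $\operatorname{rk}$ on each connected component of $P$ is $0$. A weakly graded poset is strongly graded if all its minimal elements have the same rank and all its maximal elements have the same rank. A poset is $(\mathbf{3+1})$-avoiding if there are no four elements $x,y,z,w$ with $x<y<z$ and $w$ incomparable to each of $x,y,z$. -}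

module Defs where

open import Data.Nat as ℕ using (ℕ; zero; suc; _∸_; _^_; _!)
open import Data.Nat.Properties using (_!*_!≢0)
open import Data.Integer using (+_)
open import Data.Rational using (ℚ; _/_; _+_; _*_; _-_; ∣_∣; _≤_; _<_; 0ℚ)
open import Data.Fin using (Fin)
open import Data.Vec using (Vec; lookup)
open import Data.Bool using (Bool; true)
open import Data.List using (List; length)
open import Data.List.Membership.Propositional using (_∈_)
open import Data.List.Relation.Unary.Unique.Propositional using (Unique)
open import Data.Product using (Σ; ∃; ∃-syntax; _×_)
open import Relation.Binary.PropositionalEquality using (_≡_; _≢_)
open import Relation.Nullary using (¬_)
open import Function.Bundles using (_⇔_)

-- Binary relations on [n] = Fin n, as n×n Boolean matrices
-- (so that distinct relations are distinct elements, with ≡ decidable).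

Rel : ℕ → Set
Rel n = Vec (Vec Bool n) n

module _ {n : ℕ} (R : Rel n) where

  _≼_ : Fin n → Fin n → Set
  i ≼ j = lookup (lookup R i) j ≡ true

  IsPoset : Set
  IsPoset = (∀ i → i ≼ i)
          × (∀ i j → i ≼ j → j ≼ i → i ≡ j)
          × (∀ i j k → i ≼ j → j ≼ k → i ≼ k)

  _≺_ : Fin n → Fin n → Set
  i ≺ j = i ≼ j × i ≢ j

  Covers : Fin n → Fin n → Set
  Covers a b = a ≺ b × ¬ (∃[ c ] (a ≺ c × c ≺ b))

  Incomparable : Fin n → Fin n → Set
  Incomparable a b = ¬ (a ≼ b) × ¬ (b ≼ a)

  Avoids3+1 : Set
  Avoids3+1 = ¬ (∃[ x ] ∃[ y ] ∃[ z ] ∃[ w ]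
                   (x ≺ y × y ≺ z × Incomparable w x × Incomparable w y × Incomparable w z))

  data Connected : Fin n → Fin n → Set where
    here  : ∀ {a} → Connected a a
    stepU : ∀ {a b c} → a ≼ b → Connected b c → Connected a c
    stepD : ∀ {a b c} → b ≼ a → Connected b c → Connected a c

  Minimal : Fin n → Set
  Minimal a = ¬ (∃[ c ] (c ≺ a))

  Maximal : Fin n → Set
  Maximal a = ¬ (∃[ c ] (a ≺ c))

  IsWeakRank : (Fin n → ℕ) → Set
  IsWeakRank rk = (∀ a b → Covers a b → rk b ≡ suc (rk a))
                × (∀ a → ∃[ b ] (Connected a b × rk b ≡ 0))

  WeaklyGraded : Set
  WeaklyGraded = ∃[ rk ] IsWeakRank rk

  StronglyGraded : Set
  StronglyGraded = ∃[ rk ] (IsWeakRank rk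
                   × (∀ a b → Minimal a → Minimal b → rk a ≡ rk b)
                   × (∀ a b → Maximal a → Maximal b → rk a ≡ rk b))

IsCount : (n : ℕ) → (Rel n → Set) → ℕ → Set
IsCount n P k = Σ (List (Rel n)) λ l →
  Unique l × (∀ R → (P R ⇔ (R ∈ l))) × length l ≡ k

StrongCount : ℕ → ℕ → Set
StrongCount n = IsCount n (λ R → IsPoset R × StronglyGraded R × Avoids3+1 R)

WeakCount : ℕ → ℕ → Set
WeakCount n = IsCount n (λ R → IsPoset R × WeaklyGraded R × Avoids3+1 R)

ψterm : ℕ → ℕ → ℚ
ψterm n i = (+ (2 ^ (i ℕ.* (n ∸ i)))) / (i ! ℕ.* (n ∸ i) !)
  where instance _ = i !* (n ∸ i) !≢0

Σ≤ : ℕ → (ℕ → ℚ) → ℚ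
Σ≤ zero    f = f 0
Σ≤ (suc m) f = Σ≤ m f + f (suc m)

ψ : ℕ → ℚ
ψ n = Σ≤ n (ψterm n)

fromℕℚ : ℕ → ℚ
fromℕℚ k = (+ k) / 1

-- Asymptotic equivalence a ∼ b:  |a n - b n| ≤ ε |b n| eventually, for every ε > 0
-- (i.e. a n / b n → 1 when b n ≠ 0 eventually)

_∼_ : (ℕ → ℚ) → (ℕ → ℚ) → Set
a ∼ b = ∀ (ε : ℚ) → 0ℚ < ε → ∃[ N ] ∀ n → N ℕ.≤ n → ∣ a n - b n ∣ ≤ ε * ∣ b n ∣

{-# OPTIONS --safe #-}
module Submission where

-- Upper bound.  In a (3+1)-avoiding poset let the level of v be the length of a longest
-- chain below v.  Elements whose levels differ by at least 2 are comparable, so the poset is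
-- determined by its levels and by the comparabilities between levels of opposite parity
-- (the two colours).  If x < z have the same colour but different levels, then either every w
-- of the other colour is comparable to x or to z, or this holds for the w not strictly
-- between their levels while no w strictly between is comparable to both.  So, given one
-- further bit, each w shows one of only 3 of the 4 possible patterns towards (x , z), and
-- deleting x and z loses at most 3^b times a polynomial factor, b being the number of
-- vertices of the other colour.  When 5b ≤ 3n this is exponentially less than
-- F(n) / F(n - 2) ≥ 2^(n-1), where F(n) = Σ_c 2^(a b) = n! ψ_n counts coloured bipartite
-- graphs; when 5b > 3n, a trivial bound suffices because a b is well below n² / 4.  Hence
-- posets with at least 3 levels are negligible, and those with at most 2 levels number at
-- most F(n).
--
-- Lower bound.  A bipartite graph without isolated vertices is a strongly graded poset of
-- two levels that determines its colouring; at most 2 n F(n - 1) graphs have an isolated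
-- vertex.

open import Defs
module _ where

  open import Data.Nat as ℕ using (ℕ; zero; suc; _+_; _*_; _∸_; _^_; _/_; _≤_; _<_; _<ᵇ_; _≤ᵇ_; _≤?_; z≤n; s≤s; NonZero; ⌈_/2⌉; ∣_-_∣)
  open import Data.Nat.Properties hiding (_≟_)
  open import Data.Nat.DivMod using (m/n*n≤m; /-monoˡ-≤; m*n/n≡m; m≡m%n+[m/n]*n; m%n<n)
  open import Data.Nat.Combinatorics using (_C_; nCk+nC[k+1]≡[n+1]C[k+1]; k>n⇒nCk≡0)
  open import Data.Nat.Induction using (<-rec)
  open import Data.Nat.ListAction using (sum)
  open import Data.Nat.ListAction.Properties using (sum-++)
  open import Data.Nat.Tactic.RingSolver using (solve-∀)
  open import Algebra.Properties.CommutativeSemigroup +-commutativeSemigroup using (x∙yz≈y∙xz) renaming (interchange to +-interchange)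
  open import Data.Bool using (Bool; true; false; not; _∧_; _∨_; _xor_; if_then_else_; T)
  open import Data.Bool.Properties using (∨-identityʳ; ∨-zeroʳ; ∧-zeroʳ; ∨-comm; not-involutive; xor-same; xor-comm; xor-identityʳ; true-xor) renaming (_≟_ to _≟ᵇ_)
  open import Data.Fin using (Fin; zero; suc; punchIn; punchOut; _≟_)
  open import Data.Fin.Properties using (punchIn-punchOut; any?; all?)
  open import Data.Vec using (lookup; tabulate)
  open import Data.Vec.Properties using (lookup∘tabulate; tabulate∘lookup; tabulate-cong)
  open import Data.Vec.Functional using (insertAt) renaming (_∷_ to _◂_)
  open import Data.Vec.Functional.Properties using (insertAt-lookup; insertAt-punchIn)
  open import Data.List using (List; []; _∷_; _++_; map; concatMap; length; cartesianProduct; upTo; allFin; removeAt)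
  open import Data.List.Properties using (map-++; length-map; length-++; length-removeAt′; length-upTo; length-tabulate)
  open import Data.List.Membership.Propositional using (_∈_; lose)
  open import Data.List.Membership.Propositional.Properties using (∈-upTo⁺; ∈-allFin; ∈-cartesianProduct⁺)
  open import Data.List.Relation.Unary.Unique.Propositional using (Unique)
  open import Data.List.Relation.Unary.Any as Any using (Any; here; there)
  import Data.List.Relation.Unary.Any.Properties as Anyₚ
  open import Data.List.Relation.Unary.All as All using (All; []; _∷_)
  import Data.List.Relation.Unary.All.Properties as Allₚ
  open import Data.List.Relation.Unary.AllPairs as AllPairs using (AllPairs; []; _∷_)
  import Data.List.Relation.Unary.AllPairs.Properties as AllPairsₚ
  open import Data.Product using (∃; ∃-syntax; _×_; _,_; proj₁; proj₂)
  open import Data.Sum using (_⊎_; inj₁; inj₂)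
  open import Data.Empty using (⊥; ⊥-elim)
  open import Data.Unit using (tt)
  open import Function using (_∘_; id; _$_; _⟨_⟩_; case_of_)
  open import Relation.Binary.PropositionalEquality
  open import Relation.Nullary using (¬_; yes; no)
  open import Relation.Nullary.Decidable using (does; dec-true; dec-false; _×-dec_)

  -- Counting

  ∑ : {A : Set} → List A → (A → ℕ) → ℕ
  ∑ xs f = sum (map f xs)

  ∑-mono-≤ : {A : Set} {f g : A → ℕ} → (∀ x → f x ≤ g x) → ∀ xs → ∑ xs f ≤ ∑ xs g
  ∑-mono-≤ h []       = z≤n
  ∑-mono-≤ h (x ∷ xs) = +-mono-≤ (h x) (∑-mono-≤ h xs)

  ∑-cong : {A : Set} {f g : A → ℕ} → (∀ x → f x ≡ g x) → ∀ xs → ∑ xs f ≡ ∑ xs g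
  ∑-cong h []       = refl
  ∑-cong h (x ∷ xs) = cong₂ _+_ (h x) (∑-cong h xs)

  ∑-*ˡ : {A : Set} (k : ℕ) (f : A → ℕ) → ∀ xs → ∑ xs (λ x → k * f x) ≡ k * ∑ xs f
  ∑-*ˡ k f []       = sym (*-zeroʳ k)
  ∑-*ˡ k f (x ∷ xs) = trans (cong (k * f x +_) (∑-*ˡ k f xs)) (sym (*-distribˡ-+ k (f x) (∑ xs f)))

  ∑-const-≤ : {A : Set} {f : A → ℕ} {m : ℕ} → (∀ x → f x ≤ m) → ∀ xs → ∑ xs f ≤ length xs * m
  ∑-const-≤ h []       = z≤n
  ∑-const-≤ h (x ∷ xs) = +-mono-≤ (h x) (∑-const-≤ h xs)

  length-concatMap : {A B : Set} (f : A → List B) → ∀ xs → length (concatMap f xs) ≡ ∑ xs (length ∘ f)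
  length-concatMap f []       = refl
  length-concatMap f (x ∷ xs) = trans (length-++ (f x)) (cong (length (f x) +_) (length-concatMap f xs))

  length-concatMap-≤ : {A B : Set} (f : A → List B) {m : ℕ} → (∀ x → length (f x) ≤ m) →
                       ∀ xs → length (concatMap f xs) ≤ length xs * m
  length-concatMap-≤ f h xs = ≤-trans (≤-reflexive (length-concatMap f xs)) (∑-const-≤ h xs)

  Any-removeAt : {B : Set} {P Q : B → Set} {ys : List B} (p : Any P ys) → Any Q ys →
                 (∀ {y} → P y → Q y → ⊥) → Any Q (removeAt ys (Any.index p))
  Any-removeAt (here px)  (here qx)  h = ⊥-elim (h px qx)
  Any-removeAt (here px)  (there q)  h = q
  Any-removeAt (there p)  (here qx)  h = here qx
  Any-removeAt (there p)  (there q)  h = there (Any-removeAt p q h)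

  -- The pigeonhole principle by deletion: removing the code of the head leaves a code for every
  -- later entry, since a shared code would make that entry `~` to the head. A relation stands in
  -- for equality because functions are compared pointwise.
  distinct-codes⇒length≤ : {A B : Set} {_~_ : A → A → Set} (Q : A → B → Set) →
    (∀ {x x′ y} → Q x y → Q x′ y → x ~ x′) →
    ∀ {xs ys} → AllPairs (λ x x′ → ¬ x ~ x′) xs → All (λ x → Any (Q x) ys) xs →
    length xs ≤ length ys
  distinct-codes⇒length≤ Q inj []         []       = z≤n
  distinct-codes⇒length≤ Q inj {ys = ys} (dx ∷ dxs) (q ∷ qs) =
    ≤-trans (s≤s (distinct-codes⇒length≤ Q inj dxs
                   (All.zipWith (λ (d , a) → Any-removeAt q a (λ u v → d (inj u v))) (dx , qs))))
            (≤-reflexive (sym (length-removeAt′ ys (Any.index q))))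

  choices : {A : Set} (n : ℕ) → (Fin n → List A) → List (Fin n → A)
  choices zero    o = (λ ()) ∷ []
  choices (suc n) o = concatMap (λ a → map (a ◂_) (choices n (o ∘ suc))) (o zero)

  choices-complete : {A B : Set} (_~_ : B → A → Set) → ∀ n {o : Fin n → List A} {f : Fin n → B} →
    (∀ i → Any (f i ~_) (o i)) → Any (λ g → ∀ i → f i ~ g i) (choices n o)
  choices-complete _~_ zero    h = here (λ ())
  choices-complete _~_ (suc n) h =
    Anyₚ.concatMap⁺ _ (Any.map (λ r → Anyₚ.map⁺ (Any.map (λ { t zero → r ; t (suc i) → t i })
                                                (choices-complete _~_ n (h ∘ suc))))
                               (h zero))

  choices-sound : {A : Set} → ∀ n {o : Fin n → List A} → All (λ g → ∀ i → g i ∈ o i) (choices n o)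
  choices-sound zero        = (λ ()) ∷ []
  choices-sound (suc n) {o} = go (o zero) id
    where
    go : ∀ xs → (∀ {x} → x ∈ xs → x ∈ o zero) →
         All (λ g → ∀ i → g i ∈ o i) (concatMap (λ a → map (a ◂_) (choices n (o ∘ suc))) xs)
    go []       sub = []
    go (x ∷ xs) sub = Allₚ.++⁺
      (Allₚ.map⁺ (All.map (λ { t zero → sub (here refl) ; t (suc i) → t i }) (choices-sound n)))
      (go xs (sub ∘ there))

  choices-distinct : {A : Set} (_~_ : A → A → Set) → ∀ n {o : Fin n → List A} →
    (∀ i → AllPairs (λ x y → ¬ x ~ y) (o i)) → AllPairs (λ f g → ¬ (∀ i → f i ~ g i)) (choices n o)
  choices-distinct _~_ zero    h = [] ∷ []
  choices-distinct _~_ (suc n) {o} h = go (h zero)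
    where
    go : ∀ {xs} → AllPairs (λ x y → ¬ x ~ y) xs →
         AllPairs (λ f g → ¬ (∀ i → f i ~ g i)) (concatMap (λ a → map (a ◂_) (choices n (o ∘ suc))) xs)
    go []         = []
    go {x ∷ xs} (dx ∷ dxs) = AllPairsₚ.++⁺
      (AllPairsₚ.map⁺ (AllPairs.map (λ ne eq → ne (eq ∘ suc)) (choices-distinct _~_ n (h ∘ suc))))
      (go dxs)
      (Allₚ.map⁺ (All.universal (λ f → Allₚ.concat⁺ (Allₚ.map⁺ (All.map
        (λ ne → Allₚ.map⁺ (All.universal (λ g eq → ne (eq zero)) _)) dx))) _))

  -- Counting the true values of a Boolean function

  ⟦_⟧ : Bool → ℕ
  ⟦ true  ⟧ = 1
  ⟦ false ⟧ = 0

  # : ∀ {n} → (Fin n → Bool) → ℕ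
  # {zero}  p = 0
  # {suc n} p = ⟦ p zero ⟧ + # (p ∘ suc)

  ⟦⟧-mono : ∀ {a b} → (a ≡ true → b ≡ true) → ⟦ a ⟧ ≤ ⟦ b ⟧
  ⟦⟧-mono {false} h = z≤n
  ⟦⟧-mono {true}  h = ≤-reflexive (sym (cong ⟦_⟧ (h refl)))

  #-cong : ∀ {n} {p q : Fin n → Bool} → p ≗ q → # p ≡ # q
  #-cong {zero}  h = refl
  #-cong {suc n} h = cong₂ _+_ (cong ⟦_⟧ (h zero)) (#-cong (h ∘ suc))

  #-mono-≤ : ∀ {n} {p q : Fin n → Bool} → (∀ i → p i ≡ true → q i ≡ true) → # p ≤ # q
  #-mono-≤ {zero}  h = z≤n
  #-mono-≤ {suc n} h = +-mono-≤ (⟦⟧-mono (h zero)) (#-mono-≤ (h ∘ suc))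

  #-mono-< : ∀ {n} {p q : Fin n → Bool} → (∀ i → p i ≡ true → q i ≡ true) →
             ∀ v → p v ≡ false → q v ≡ true → # p < # q
  #-mono-< {suc n} h zero    pv qv rewrite pv | qv = s≤s (#-mono-≤ (h ∘ suc))
  #-mono-< {suc n} h (suc v) pv qv = +-mono-≤-< (⟦⟧-mono (h zero)) (#-mono-< (h ∘ suc) v pv qv)

  #≤n : ∀ {n} (p : Fin n → Bool) → # p ≤ n
  #≤n {zero}  p = z≤n
  #≤n {suc n} p with p zero
  ... | true  = s≤s (#≤n (p ∘ suc))
  ... | false = m≤n⇒m≤1+n (#≤n (p ∘ suc))

  #-punchIn : ∀ {n} (p : Fin (suc n) → Bool) v → # p ≡ ⟦ p v ⟧ + # (p ∘ punchIn v)
  #-punchIn         p zero    = refl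
  #-punchIn {suc n} p (suc v) = begin
    ⟦ p zero ⟧ + # (p ∘ suc)                                    ≡⟨ cong (⟦ p zero ⟧ +_) (#-punchIn (p ∘ suc) v) ⟩
    ⟦ p zero ⟧ + (⟦ p (suc v) ⟧ + # (p ∘ suc ∘ punchIn v))      ≡⟨ x∙yz≈y∙xz ⟦ p zero ⟧ ⟦ p (suc v) ⟧ _ ⟩
    ⟦ p (suc v) ⟧ + (⟦ p zero ⟧ + # (p ∘ suc ∘ punchIn v))      ∎
    where
    open ≡-Reasoning

  #+#not≡n : ∀ {n} (p : Fin n → Bool) → # p + # (not ∘ p) ≡ n
  #+#not≡n {zero}  p = refl
  #+#not≡n {suc n} p with p zero
  ... | true  = cong suc (#+#not≡n (p ∘ suc))
  ... | false = trans (+-suc (# (p ∘ suc)) _) (cong suc (#+#not≡n (p ∘ suc)))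

  -- Positions outside `p` are forced and contribute a factor 1. Nested use, with `m` the number of
  -- possible rows, counts matrices.
  length-choices : {A : Set} {m : ℕ} → ∀ n {o : Fin n → List A} (p : Fin n → Bool) →
    (∀ i → length (o i) ≡ (if p i then m else 1)) → length (choices n o) ≡ m ^ # p
  length-choices zero    p h = refl
  length-choices {m = m} (suc n) {o} p h = trans (go (o zero)) lem
    where
    go : ∀ xs → length (concatMap (λ a → map (a ◂_) (choices n (o ∘ suc))) xs) ≡ length xs * m ^ # (p ∘ suc)
    go []       = refl
    go (x ∷ xs) = trans (length-++ (map (x ◂_) (choices n (o ∘ suc))))
      (cong₂ _+_ (trans (length-map (x ◂_) (choices n (o ∘ suc))) (length-choices n (p ∘ suc) (h ∘ suc))) (go xs))
    lem : length (o zero) * m ^ # (p ∘ suc) ≡ m ^ # p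
    lem rewrite h zero with p zero
    ... | true  = refl
    ... | false = *-identityˡ _

  -- Inserting an index, and Boolean comparisons

  insertAt-≗ : ∀ {n} {A : Set} {f : Fin (suc n) → A} {g : Fin n → A} {v a} →
    f v ≡ a → (∀ j → f (punchIn v j) ≡ g j) → f ≗ insertAt g v a
  insertAt-≗ {f = f} {g} {v} {a} hv hj i with v Data.Fin.≟ i
  ... | yes refl = trans hv (sym (insertAt-lookup g v a))
  ... | no  v≢i = subst (λ k → f k ≡ insertAt g v a k) (punchIn-punchOut v≢i)
                    (trans (hj _) (sym (insertAt-punchIn g v a _)))

  border : ∀ {n} {A : Set} → Fin (suc n) → (row col : Fin n → A) → A → (Fin n → Fin n → A) → Fin (suc n) → Fin (suc n) → A
  border v row col d M = insertAt (λ i → insertAt (M i) v (col i)) v (insertAt row v d)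

  border-≗ : ∀ {n} {A : Set} {M : Fin (suc n) → Fin (suc n) → A} {N row col d v} →
    M v v ≡ d → (∀ j → M v (punchIn v j) ≡ row j) → (∀ j → M (punchIn v j) v ≡ col j) →
    (∀ j k → M (punchIn v j) (punchIn v k) ≡ N j k) →
    ∀ i k → M i k ≡ border v row col d N i k
  border-≗ {M = M} {N} {row} {col} {d} {v} hd hr hc hN i k with v Data.Fin.≟ i
  ... | yes refl = trans (insertAt-≗ {f = M v} {v = v} hd hr k) (cong-app (sym (insertAt-lookup _ v _)) k)
  ... | no  v≢i = subst (λ m → M m k ≡ border v row col d N m k) (punchIn-punchOut v≢i)
      (trans (insertAt-≗ {f = M (punchIn v j)} {v = v} (hc j) (hN j) k) (cong-app (sym (insertAt-punchIn _ v _ j)) k))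
    where j = punchOut v≢i

  T⇒≡true : ∀ {b} → T b → b ≡ true
  T⇒≡true {true} _ = refl

  ≡true⇒T : ∀ {b} → b ≡ true → T b
  ≡true⇒T refl = tt

  <⇒<ᵇ≡true : ∀ {m n} → m < n → (m <ᵇ n) ≡ true
  <⇒<ᵇ≡true m<n = T⇒≡true (<⇒<ᵇ m<n)

  <ᵇ≡true⇒< : ∀ m n → (m <ᵇ n) ≡ true → m < n
  <ᵇ≡true⇒< m n e = <ᵇ⇒< m n (≡true⇒T e)

  ≤⇒<ᵇ≡false : ∀ {m n} → n ≤ m → (m <ᵇ n) ≡ false
  ≤⇒<ᵇ≡false {m} {n} n≤m with m <ᵇ n in e
  ... | false = refl
  ... | true  = ⊥-elim (<-irrefl refl (<-≤-trans (<ᵇ≡true⇒< m n e) n≤m))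

  <ᵇ-cong-⇔ : ∀ {a b c d} → (a < b → c < d) → (b ≤ a → d ≤ c) → (a <ᵇ b) ≡ (c <ᵇ d)
  <ᵇ-cong-⇔ {a} {b} lt ge with a ℕ.<? b
  ... | yes a<b = trans (<⇒<ᵇ≡true a<b) (sym (<⇒<ᵇ≡true (lt a<b)))
  ... | no  a≮b = trans (≤⇒<ᵇ≡false (≮⇒≥ a≮b)) (sym (≤⇒<ᵇ≡false (ge (≮⇒≥ a≮b))))

  -- Twice the midrank: comparing ranks reproduces comparing levels, so that a new level inserted
  -- among n old ones needs only 2n + 1 values.
  rank : ∀ {n} → (Fin n → ℕ) → ℕ → ℕ
  rank lv t = # (λ u → lv u <ᵇ t) + # (λ u → not (t <ᵇ lv u))

  module _ {n : ℕ} (lv : Fin n → ℕ) where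

    <ᵇ-monoʳ : ∀ {t t′} → t ≤ t′ → ∀ u → (lv u <ᵇ t) ≡ true → (lv u <ᵇ t′) ≡ true
    <ᵇ-monoʳ t≤t′ u e = <⇒<ᵇ≡true (<-≤-trans (<ᵇ≡true⇒< _ _ e) t≤t′)

    ≮ᵇ-monoˡ : ∀ {t t′} → t ≤ t′ → ∀ u → not (t <ᵇ lv u) ≡ true → not (t′ <ᵇ lv u) ≡ true
    ≮ᵇ-monoˡ {t} t≤t′ u e with t ℕ.<? lv u
    ... | no t≮ = cong not (≤⇒<ᵇ≡false (≤-trans (≮⇒≥ t≮) t≤t′))
    ... | yes t< with () ← trans (sym e) (cong not (<⇒<ᵇ≡true t<))

    rank-mono : ∀ {t t′} → t ≤ t′ → rank lv t ≤ rank lv t′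
    rank-mono t≤t′ = +-mono-≤ (#-mono-≤ (<ᵇ-monoʳ t≤t′)) (#-mono-≤ (≮ᵇ-monoˡ t≤t′))

    rank-level< : ∀ {t} v → lv v < t → rank lv (lv v) < rank lv t
    rank-level< v v<t = +-mono-<-≤
      (#-mono-< (<ᵇ-monoʳ (<⇒≤ v<t)) v (≤⇒<ᵇ≡false {lv v} {lv v} ≤-refl) (<⇒<ᵇ≡true v<t))
      (#-mono-≤ (≮ᵇ-monoˡ (<⇒≤ v<t)))

    rank-<level : ∀ {t} v → t < lv v → rank lv t < rank lv (lv v)
    rank-<level v t<v = +-mono-≤-<
      (#-mono-≤ (<ᵇ-monoʳ (<⇒≤ t<v)))
      (#-mono-< (≮ᵇ-monoˡ (<⇒≤ t<v)) v (cong not (<⇒<ᵇ≡true t<v)) (cong not (≤⇒<ᵇ≡false {lv v} {lv v} ≤-refl)))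

    -- Monotonicity settles the case `t ≤ lv v`. Strictness in the other case comes from `v` itself,
    -- which the first sum of `rank` counts at `t` but not at `lv v`.
    rank-level-<ᵇ : ∀ v t → (lv v <ᵇ t) ≡ (rank lv (lv v) <ᵇ rank lv t)
    rank-level-<ᵇ v t = <ᵇ-cong-⇔ (rank-level< v) rank-mono

    -- Here the strict gain is in the second sum of `rank`, which counts `v` at `lv v` but not at
    -- `t`.
    rank-<ᵇ-level : ∀ t v → (t <ᵇ lv v) ≡ (rank lv t <ᵇ rank lv (lv v))
    rank-<ᵇ-level t v = <ᵇ-cong-⇔ (rank-<level v) rank-mono

    rank<1+2n : ∀ t → rank lv t < suc (n + n)
    rank<1+2n t = s≤s (+-mono-≤ (#≤n (λ u → lv u <ᵇ t)) (#≤n (λ u → not (t <ᵇ lv u))))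

  -- Levelled two-coloured structures

  -- Only the comparison matrix of the levels is kept: level functions that order the vertices alike
  -- give the same structure.
  record Str (n : ℕ) : Set where
    constructor str
    field
      col : Fin n → Bool
      lt  : Fin n → Fin n → Bool
      adj : Fin n → Fin n → Bool

  open Str

  infix 4 _≈_
  _≈_ : ∀ {n} → Str n → Str n → Set
  s ≈ t = (∀ i → col s i ≡ col t i) × (∀ i j → lt s i j ≡ lt t i j) × (∀ i j → adj s i j ≡ adj t i j)

  -- The two values leave out opposite corners: `true` forbids adjacency to both vertices of a pair,
  -- `false` forbids adjacency to neither. Three patterns remain either way, which is the source of
  -- the base 3.
  patterns : Bool → List (Bool × Bool)
  patterns true  = (false , false) ∷ (true , false) ∷ (false , true) ∷ []
  patterns false = (true  , true)  ∷ (true , false) ∷ (false , true) ∷ []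

  -- The hereditary part of what a (3+1)-avoiding poset says about its levels.
  record Good {n} (s : Str n) : Set where
    field
      level    : Fin n → ℕ
      lt-level : ∀ i j → lt s i j ≡ (level i <ᵇ level j)
      adj-sym  : ∀ i j → adj s i j ≡ adj s j i
      adj-supp : ∀ i j → col s i ≡ col s j → adj s i j ≡ false
      pair     : ∀ x z → col s x ≡ col s z → lt s x z ≡ true →
                 ∃[ b ] ∀ w → col s w xor col s x ≡ true →
                 (adj s x w , adj s z w) ∈ patterns (b ∧ (lt s x w ∧ lt s w z))

  restrict : ∀ {m n} → (Fin m → Fin n) → Str n → Str m
  restrict e s = str (col s ∘ e) (λ i j → lt s (e i) (e j)) (λ i j → adj s (e i) (e j))

  -- Every clause is universal in the vertices and so survives reindexing; the bit of a pair is
  -- inherited unchanged.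
  restrict-good : ∀ {m n} (e : Fin m → Fin n) {s} → Good s → Good (restrict e s)
  restrict-good e g = record
    { level    = level ∘ e
    ; lt-level = λ i j → lt-level (e i) (e j)
    ; adj-sym  = λ i j → adj-sym (e i) (e j)
    ; adj-supp = λ i j → adj-supp (e i) (e j)
    ; pair     = λ x z cx lx → let b , h = pair (e x) (e z) cx lx in b , λ w → h (e w)
    } where open Good g

  bools : List Bool
  bools = true ∷ false ∷ []

  ∈-bools : ∀ b → b ∈ bools
  ∈-bools true  = here refl
  ∈-bools false = there (here refl)

  -- Coloured bipartite graphs

  Bip : ℕ → Set
  Bip n = (Fin n → Bool) × (Fin n → Fin n → Bool)

  colourings : ∀ n → List (Fin n → Bool)
  colourings n = choices n (λ _ → bools)

  entries : Bool → List Bool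
  entries b = if b then bools else false ∷ []

  -- Only entries from a vertex coloured `false` to one coloured `true` are free, so each unordered
  -- two-coloured pair is decided once.
  graphs : ∀ {n} → (Fin n → Bool) → List (Fin n → Fin n → Bool)
  graphs {n} c = choices n (λ i → choices n (λ j → entries (not (c i) ∧ c j)))

  bips : ∀ n → List (Bip n)
  bips n = concatMap (λ c → map (c ,_) (graphs c)) (colourings n)

  edges : ∀ {n} → (Fin n → Bool) → ℕ
  edges c = # c * # (not ∘ c)

  length-entries : ∀ b → length (entries b) ≡ (if b then 2 else 1)
  length-entries true  = refl
  length-entries false = refl

  #-false : ∀ n → # {n} (λ _ → false) ≡ 0
  #-false zero    = refl
  #-false (suc n) = #-false n

  length-graphs : ∀ {n} (c : Fin n → Bool) → length (graphs c) ≡ 2 ^ edges c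
  length-graphs {n} c = trans (length-choices n (not ∘ c) row) (^-*-assoc 2 (# c) (# (not ∘ c)))
    where
    row : ∀ i → length (choices n (λ j → entries (not (c i) ∧ c j))) ≡ (if not (c i) then 2 ^ # c else 1)
    row i with not (c i)
    ... | true  = length-choices n c (λ j → length-entries (c j))
    ... | false = trans (length-choices {m = 2} n (λ _ → false) (λ j → refl)) (cong (2 ^_) (#-false n))

  F : ℕ → ℕ
  F n = ∑ (colourings n) (λ c → 2 ^ edges c)

  length-bips : ∀ n → length (bips n) ≡ F n
  length-bips n = trans (length-concatMap (λ c → map (c ,_) (graphs c)) (colourings n))
    (∑-cong (λ c → trans (length-map (c ,_) (graphs c)) (length-graphs c)) (colourings n))

  colourings-complete : ∀ {n} (c : Fin n → Bool) → Any (λ c′ → ∀ i → c i ≡ c′ i) (colourings n)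
  colourings-complete {n} c = choices-complete _≡_ n (λ i → ∈-bools (c i))

  graphs-complete : ∀ {n} (c : Fin n → Bool) (g : Fin n → Fin n → Bool) →
    (∀ i j → not (c i) ∧ c j ≡ false → g i j ≡ false) →
    Any (λ g′ → ∀ i j → g i j ≡ g′ i j) (graphs c)
  graphs-complete {n} c g supp =
    choices-complete (λ (r r′ : Fin n → Bool) → ∀ j → r j ≡ r′ j) n {f = g} (λ i → choices-complete _≡_ n {f = g i} (λ j → mem _ _ (supp i j)))
    where
    mem : ∀ b d → (b ≡ false → d ≡ false) → Any (d ≡_) (entries b)
    mem true  true  h = here refl
    mem true  false h = there (here refl)
    mem false d     h = here (h refl)

  orient : ∀ {n} → Str n → (c : Fin n → Bool) → Fin n → Fin n → Bool
  orient s c i j = (not (c i) ∧ c j) ∧ adj s i j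

  orient-supp : ∀ {n} (s : Str n) c i j → not (c i) ∧ c j ≡ false → orient s c i j ≡ false
  orient-supp s c i j e rewrite e = refl

  symmetrize : ∀ {n} → (Fin n → Fin n → Bool) → Fin n → Fin n → Bool
  symmetrize g i j = g i j ∨ g j i

  module _ {n : ℕ} {s : Str n} (good : Good s) where
    open Good good

    -- Orienting keeps one of the two equal entries of each two-coloured pair, and the entries it
    -- discards within a colour are `false` by `adj-supp`; so no information is lost.
    symmetrize-orient : ∀ {c g} → (∀ i → col s i ≡ c i) → (∀ i j → orient s c i j ≡ g i j) →
                        ∀ i j → adj s i j ≡ symmetrize g i j
    symmetrize-orient {c} {g} hc hg i j rewrite sym (hg i j) | sym (hg j i) | adj-sym j i
      with c i in ei | c j in ej | adj s i j in ea
    ... | true  | true  | false = refl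
    ... | true  | false | false = refl
    ... | false | true  | false = refl
    ... | false | false | false = refl
    ... | true  | false | true  = refl
    ... | false | true  | true  = refl
    ... | true  | true  | true  with () ← trans (sym ea) (adj-supp i j (trans (hc i) (trans ei (sym (trans (hc j) ej)))))
    ... | false | false | true  with () ← trans (sym ea) (adj-supp i j (trans (hc i) (trans ei (sym (trans (hc j) ej)))))

  -- Structures whose level is decided by the colour

  byColour : ∀ {n} → (Bool → Bool → Bool) → Bip n → Str n
  byColour f (c , g) = str c (λ i j → f (c i) (c j)) (symmetrize g)

  byColour-complete : ∀ {n} {s : Str n} → Good s → ∀ f →
    (∀ i j → lt s i j ≡ f (col s i) (col s j)) → Any (s ≈_) (map (byColour f) (bips n))
  byColour-complete {s = s} good f h = Anyₚ.map⁺ (Anyₚ.concatMap⁺ _ (Any.map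
    (λ {c} hc → Anyₚ.map⁺ (Any.map
      (λ hg → hc , (λ i j → trans (h i j) (cong₂ f (hc i) (hc j))) , symmetrize-orient good hc hg)
      (graphs-complete c (orient s c) (orient-supp s c))))
    (colourings-complete (col s))))

  upward downward flat : Bool → Bool → Bool
  upward   a b = not a ∧ b
  downward a b = a ∧ not b
  flat     a b = false

  -- If each colour class lies on a single level, these are the possible outcomes of comparing the
  -- two levels.
  modes : List (Bool → Bool → Bool)
  modes = upward ∷ downward ∷ flat ∷ []

  base : ∀ n → List (Str n)
  base n = concatMap (λ f → map (byColour f) (bips n)) modes

  length-base : ∀ n → length (base n) ≤ 3 * F n
  length-base n = length-concatMap-≤ (λ f → map (byColour f) (bips n)) (λ f → ≤-reflexive (trans (length-map (byColour f) (bips n)) (length-bips n))) modes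

  upward⇒ : ∀ {a b} → upward a b ≡ true → a ≡ false × b ≡ true
  upward⇒ {false} {true} _ = refl , refl

  downward⇒ : ∀ {a b} → downward a b ≡ true → a ≡ true × b ≡ false
  downward⇒ {true} {false} _ = refl , refl

  module _ {n : ℕ} {s : Str n} (good : Good s)
           (const : ¬ (∃[ x ] ∃[ z ] (col s x ≡ col s z × lt s x z ≡ true))) where
    open Good good

    same-level : ∀ {i j} → col s i ≡ col s j → level i ≡ level j
    same-level {i} {j} e = ≤-antisym
      (≮⇒≥ λ l → const (j , i , sym e , trans (lt-level j i) (<⇒<ᵇ≡true l)))
      (≮⇒≥ λ l → const (i , j , e , trans (lt-level i j) (<⇒<ᵇ≡true l)))

    level<-by-colour : ∀ {i j u v} → lt s i j ≡ true → col s u ≡ col s i → col s v ≡ col s j → level u < level v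
    level<-by-colour {i} {j} lij eu ev = subst₂ _<_ (same-level (sym eu)) (same-level (sym ev))
      (<ᵇ≡true⇒< _ _ (trans (sym (lt-level i j)) lij))

    module _ {i j : Fin n} (lij : lt s i j ≡ true) where

      lt-upward : upward (col s i) (col s j) ≡ true → ∀ u v → lt s u v ≡ upward (col s u) (col s v)
      lt-upward cij u v rewrite lt-level u v with ci , cj ← upward⇒ cij with col s u in eu | col s v in ev
      ... | true  | true  = ≤⇒<ᵇ≡false (≤-reflexive (same-level (trans ev (sym eu))))
      ... | false | false = ≤⇒<ᵇ≡false (≤-reflexive (same-level (trans ev (sym eu))))
      ... | false | true  = <⇒<ᵇ≡true (level<-by-colour lij (trans eu (sym ci)) (trans ev (sym cj)))
      ... | true  | false = ≤⇒<ᵇ≡false (<⇒≤ (level<-by-colour lij (trans ev (sym ci)) (trans eu (sym cj))))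

      lt-downward : downward (col s i) (col s j) ≡ true → ∀ u v → lt s u v ≡ downward (col s u) (col s v)
      lt-downward cij u v rewrite lt-level u v with ci , cj ← downward⇒ cij with col s u in eu | col s v in ev
      ... | true  | true  = ≤⇒<ᵇ≡false (≤-reflexive (same-level (trans ev (sym eu))))
      ... | false | false = ≤⇒<ᵇ≡false (≤-reflexive (same-level (trans ev (sym eu))))
      ... | true  | false = <⇒<ᵇ≡true (level<-by-colour lij (trans eu (sym ci)) (trans ev (sym cj)))
      ... | false | true  = ≤⇒<ᵇ≡false (<⇒≤ (level<-by-colour lij (trans ev (sym ci)) (trans eu (sym cj))))

    inMode : Any (λ f → Any (s ≈_) (map (byColour f) (bips n))) modes → Any (s ≈_) (base n)
    inMode = Anyₚ.concatMap⁺ (λ f → map (byColour f) (bips n)) {xs = modes}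

    -- As each class has a single level, one strict comparison between the colours fixes all others.
    -- If none is found in either direction, all vertices share one level.
    base-complete : Any (s ≈_) (base n)
    base-complete
      with any? (λ i → any? (λ j → upward (col s i) (col s j) ≟ᵇ true ×-dec lt s i j ≟ᵇ true))
         | any? (λ i → any? (λ j → downward (col s i) (col s j) ≟ᵇ true ×-dec lt s i j ≟ᵇ true))
    ... | yes (i , j , cij , lij) | _ =
      inMode (here (byColour-complete good upward (lt-upward lij cij)))
    ... | no _ | yes (i , j , cij , lij) =
      inMode (there (here (byColour-complete good downward (lt-downward lij cij))))
    ... | no ¬up | no ¬down = inMode (there (there (here (byColour-complete good flat lt-flat))))
      where
      lt-flat : ∀ u v → lt s u v ≡ false
      lt-flat u v with lt s u v in e | col s u in eu | col s v in ev
      ... | false | _     | _     = refl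
      ... | true  | true  | true  = ⊥-elim (const (u , v , trans eu (sym ev) , e))
      ... | true  | false | false = ⊥-elim (const (u , v , trans eu (sym ev) , e))
      ... | true  | false | true  = ⊥-elim (¬up (u , v , cong₂ upward eu ev , e))
      ... | true  | true  | false = ⊥-elim (¬down (u , v , cong₂ downward eu ev , e))

  -- Crude codes for unbalanced colourings

  levelled : ∀ {n} → (Fin n → Bool) → (Fin n → Fin n → Bool) → (Fin n → ℕ) → Str n
  levelled c g l = str c (λ i j → l i <ᵇ l j) (symmetrize g)

  -- Replacing each level by its `rank` preserves all comparisons and leaves 2n + 1 possible values
  -- per vertex. The resulting factor (2n + 1)^n is affordable because the graph count of an
  -- unbalanced colouring falls short by a quadratic exponent.
  crudeCodes : ∀ {n} → (Fin n → Bool) → List (Str n)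
  crudeCodes {n} c = concatMap (λ g → map (levelled c g) (choices n (λ _ → upTo (suc (n + n))))) (graphs c)

  -- That is, edges c ≤ (24/25) n² / 4.
  unbalanced : ∀ {n} → (Fin n → Bool) → Bool
  unbalanced {n} c = 100 * edges c + n * n ≤ᵇ 25 * (n * n)

  crudeOf : ∀ {n} → (Fin n → Bool) → List (Str n)
  crudeOf c = if unbalanced c then crudeCodes c else []

  crude : ∀ n → List (Str n)
  crude n = concatMap crudeOf (colourings n)

  #-true : ∀ n → # {n} (λ _ → true) ≡ n
  #-true zero    = refl
  #-true (suc n) = cong suc (#-true n)

  length-crudeCodes : ∀ {n} (c : Fin n → Bool) → length (crudeCodes c) ≤ 2 ^ edges c * suc (n + n) ^ n
  length-crudeCodes {n} c = ≤-trans
    (length-concatMap-≤ (λ g → map (levelled c g) (choices n _)) (λ g → ≤-reflexive (trans (length-map (levelled c g) (choices n _)) len)) (graphs c))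
    (≤-reflexive (cong (_* suc (n + n) ^ n) (length-graphs c)))
    where
    len : length (choices n (λ _ → upTo (suc (n + n)))) ≡ suc (n + n) ^ n
    len = trans (length-choices n (λ _ → true) (λ i → length-upTo (suc (n + n)))) (cong (suc (n + n) ^_) (#-true n))

  crude-complete : ∀ {n} {s : Str n} → Good s → 100 * edges (col s) + n * n ≤ 25 * (n * n) →
                   Any (s ≈_) (crude n)
  crude-complete {n} {s} good unb = Anyₚ.concatMap⁺ crudeOf (Any.map step (colourings-complete (col s)))
    where
    open Good good
    step : ∀ {c} → (∀ i → col s i ≡ c i) → Any (s ≈_) (crudeOf c)
    step {c} hc with unbalanced c in e
    ... | false with () ← trans (sym e) (T⇒≡true (≤⇒≤ᵇ {100 * edges c + n * n}
            (subst (λ k → 100 * k + n * n ≤ 25 * (n * n)) (cong₂ _*_ (#-cong hc) (#-cong (cong not ∘ hc))) unb)))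
    ... | true = Anyₚ.concatMap⁺ _ (Any.map
      (λ hg → Anyₚ.map⁺ (Any.map
        (λ {l} hl → hc
           , (λ i j → trans (lt-level i j) (trans (rank-level-<ᵇ level i (level j)) (cong₂ _<ᵇ_ (hl i) (hl j))))
           , symmetrize-orient good hc hg)
        (choices-complete _≡_ n {f = rank level ∘ level} (λ i → ∈-upTo⁺ (rank<1+2n level (level i))))))
      (graphs-complete c (orient s c) (orient-supp s c)))

  -- Deleting two vertices of one colour

  Param : ℕ → Set
  Param n = Fin (2 + n) × Fin (1 + n) × Bool × ℕ × ℕ × Bool

  product₆ : ∀ {A B C D E G : Set} → List A → List B → List C → List D → List E → List G → List (A × B × C × D × E × G)
  product₆ as bs cs ds es gs = cartesianProduct as $ cartesianProduct bs $ cartesianProduct cs $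
    cartesianProduct ds $ cartesianProduct es gs

  params : ∀ n → List (Param n)
  params n = product₆ (allFin (2 + n)) (allFin (1 + n)) bools (upTo (suc (n + n))) (upTo (suc (n + n))) bools

  -- The function rank, computed from the comparison matrix alone.
  midrank : ∀ {n} → Str n → Fin n → ℕ
  midrank s i = # (λ u → lt s u i) + # (λ u → not (lt s i u))

  -- Undoes the deletion of a pair. A parameter holds the place of `x`, the place of `z` once `x` is
  -- gone, their common colour, the midranks of their levels among the other vertices, and the bit
  -- of the `pair` clause. The entries `true` and `false` at `z` record that `x` is on the lower
  -- level; `f` lists the adjacencies to `x` and `z`.
  extend : ∀ {n} → Str n → Param n → (Fin n → Bool × Bool) → Str (2 + n)
  extend s (x , z , a , ℓx , ℓz , _) f = str
    (insertAt (insertAt (col s) z a) x a)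
    (border x (insertAt (λ w → ℓx <ᵇ midrank s w) z true) (insertAt (λ w → midrank s w <ᵇ ℓx) z false) false
      (border z (λ w → ℓz <ᵇ midrank s w) (λ w → midrank s w <ᵇ ℓz) false (lt s)))
    (border x (insertAt (proj₁ ∘ f) z false) (insertAt (proj₁ ∘ f) z false) false
      (border z (proj₂ ∘ f) (proj₂ ∘ f) false (adj s)))

  options : ∀ {n} → Str n → Param n → Fin n → List (Bool × Bool)
  options s (x , z , a , ℓx , ℓz , b) w =
    if col s w xor a then patterns (b ∧ ((ℓx <ᵇ midrank s w) ∧ (midrank s w <ᵇ ℓz))) else (false , false) ∷ []

  opposite : ∀ {n} → (Fin n → Bool) → Bool → ℕ
  opposite c a = # (λ w → c w xor a)

  -- The threshold 3/5 serves both sides: up to it the 3-fold choices are exponentially fewer than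
  -- 2^(2 + n), since 3^3 < 2^5, and beyond it the colouring is unbalanced.
  few : ∀ {n} → (Fin n → Bool) → Bool → Bool
  few {n} c a = 5 * opposite c a ≤ᵇ 3 * (2 + n)

  rows : ∀ {n} → Str n → Param n → List (Fin n → Bool × Bool)
  rows {n} s p@(_ , _ , a , _) = if few (col s) a then choices n (options s p) else []

  pairCodes : ∀ {n} → List (Str n) → List (Str (2 + n))
  pairCodes {n} = concatMap (λ s → concatMap (λ p → map (extend s p) (rows s p)) (params n))

  length-cartesianProduct : ∀ {A B : Set} (xs : List A) (ys : List B) →
    length (cartesianProduct xs ys) ≡ length xs * length ys
  length-cartesianProduct []       ys = refl
  length-cartesianProduct (x ∷ xs) ys = trans (length-++ (map (x ,_) ys))
    (cong₂ _+_ (length-map (x ,_) ys) (length-cartesianProduct xs ys))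

  length-product₆ : ∀ {A B C D E G : Set} (as : List A) (bs : List B) (cs : List C) (ds : List D) (es : List E) (gs : List G) →
    length (product₆ as bs cs ds es gs) ≡
    length as * (length bs * (length cs * (length ds * (length es * length gs))))
  length-product₆ as bs cs ds es gs =
    step as $ step bs $ step cs $ step ds $ length-cartesianProduct es gs
    where
    step : ∀ {A B : Set} (xs : List A) {ys : List B} {l} → length ys ≡ l →
           length (cartesianProduct xs ys) ≡ length xs * l
    step xs {ys} q = trans (length-cartesianProduct xs ys) (cong (length xs *_) q)

  paramCount : ℕ → ℕ
  paramCount n = (2 + n) * ((1 + n) * (2 * (suc (n + n) * (suc (n + n) * 2))))

  length-params : ∀ n → length (params n) ≡ paramCount n
  length-params n = trans
    (length-product₆ (allFin (2 + n)) (allFin (1 + n)) bools (upTo (suc (n + n))) (upTo (suc (n + n))) bools)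
    (cong₂ _*_ (length-tabulate {n = 2 + n} id) (cong₂ _*_ (length-tabulate {n = 1 + n} id)
      (cong (λ k → 2 * (k * (k * 2))) (length-upTo (suc (n + n))))))

  length-patterns : ∀ b → length (patterns b) ≡ 3
  length-patterns true  = refl
  length-patterns false = refl

  length-rows : ∀ {n} t → (∀ k → 5 * k ≤ 3 * (2 + n) → k ≤ t) → ∀ (s : Str n) p → length (rows s p) ≤ 3 ^ t
  length-rows {n} t ht s p@(_ , _ , a , _) with few (col s) a in e
  ... | false = z≤n
  ... | true  = ≤-trans (≤-reflexive (length-choices n (λ w → col s w xor a) row))
                        (^-monoʳ-≤ 3 (ht (opposite (col s) a) (≤ᵇ⇒≤ _ _ (≡true⇒T e))))
    where
    row : ∀ i → length (options s p i) ≡ (if col s i xor a then 3 else 1)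
    row i with col s i xor a
    ... | true  = length-patterns (proj₂ (proj₂ (proj₂ (proj₂ (proj₂ p)))) ∧ _)
    ... | false = refl

  length-pairCodes : ∀ {n} t → (∀ k → 5 * k ≤ 3 * (2 + n) → k ≤ t) → ∀ L →
    length (pairCodes {n} L) ≤ length L * (length (params n) * 3 ^ t)
  length-pairCodes {n} t ht L = length-concatMap-≤ _ (λ s → length-concatMap-≤ (λ p → map (extend s p) (rows s p))
    (λ p → ≤-trans (≤-reflexive (length-map (extend s p) (rows s p))) (length-rows t ht s p)) (params n)) L

  module _ {n : ℕ} {s : Str (2 + n)} (good : Good s) {x z : Fin (2 + n)}
           (cxz : col s x ≡ col s z) (lxz : lt s x z ≡ true) where
    open Good good

    x≢z : x ≢ z
    x≢z refl with () ← trans (sym lxz) (trans (lt-level x x) (≤⇒<ᵇ≡false {level x} ≤-refl))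

    z′ : Fin (1 + n)
    z′ = punchOut x≢z

    others : Fin n → Fin (2 + n)
    others w = punchIn x (punchIn z′ w)

    pz′ : punchIn x z′ ≡ z
    pz′ = punchIn-punchOut x≢z

    private
      a = col s x
      lv = level ∘ others
      bit = proj₁ (pair x z cxz lxz)

    -- Both deleted vertices have colour `a`, so neither contributes to the count.
    opposite-others : opposite (col s ∘ others) a ≡ opposite (col s) a
    opposite-others = sym (begin
      # p                                      ≡⟨ #-punchIn p x ⟩
      ⟦ a xor a ⟧ + # (p ∘ punchIn x)          ≡⟨ cong (λ b → ⟦ b ⟧ + # (p ∘ punchIn x)) (xor-same a) ⟩
      # (p ∘ punchIn x)                        ≡⟨ #-punchIn (p ∘ punchIn x) z′ ⟩
      ⟦ p (punchIn x z′) ⟧ + # (p ∘ others)    ≡⟨ cong (λ i → ⟦ p i ⟧ + # (p ∘ others)) pz′ ⟩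
      ⟦ p z ⟧ + # (p ∘ others)                 ≡⟨ cong (λ b → ⟦ b ⟧ + # (p ∘ others)) (trans (cong (_xor a) (sym cxz)) (xor-same a)) ⟩
      # (p ∘ others)                           ∎)
      where
      open ≡-Reasoning
      p : Fin (2 + n) → Bool
      p w = col s w xor a

    module _ {s′ : Str n} (eq : restrict others s ≈ s′) where

      code : Param n
      code = x , z′ , a , rank lv (level x) , rank lv (level z) , bit

      -- The rank of a surviving level can be read off the smaller structure, so a code has to store
      -- only the ranks of the two deleted levels.
      midrank-rank : ∀ w → rank lv (lv w) ≡ midrank s′ w
      midrank-rank w = cong₂ _+_
        (#-cong (λ u → trans (sym (lt-level _ _)) (proj₁ (proj₂ eq) u w)))
        (#-cong (λ u → cong not (trans (sym (lt-level _ _)) (proj₁ (proj₂ eq) w u))))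

      lt-from : ∀ v w → lt s v (others w) ≡ (rank lv (level v) <ᵇ midrank s′ w)
      lt-from v w = trans (lt-level v (others w)) (trans (rank-<ᵇ-level lv (level v) w)
        (cong (rank lv (level v) <ᵇ_) (midrank-rank w)))

      lt-to : ∀ v w → lt s (others w) v ≡ (midrank s′ w <ᵇ rank lv (level v))
      lt-to v w = trans (lt-level (others w) v) (trans (rank-level-<ᵇ lv w (level v))
        (cong (_<ᵇ rank lv (level v)) (midrank-rank w)))

      lt-irrefl : ∀ v → lt s v v ≡ false
      lt-irrefl v = trans (lt-level v v) (≤⇒<ᵇ≡false {level v} ≤-refl)

      rowPair : Fin n → Bool × Bool
      rowPair w = adj s x (others w) , adj s z (others w)

      rowPair∈options : ∀ w → rowPair w ∈ options s′ code w
      rowPair∈options w with col s′ w xor a in e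
      ... | true  = subst (λ b → rowPair w ∈ patterns (bit ∧ b)) (cong₂ _∧_ (lt-from x w) (lt-to z w))
                      (proj₂ (pair x z cxz lxz) (others w) (trans (cong (_xor a) (proj₁ eq w)) e))
      ... | false = here (cong₂ _,_ (adj-supp x (others w) ax) (adj-supp z (others w) (trans (sym cxz) ax)))
        where
        xor-false : ∀ {b c} → b xor c ≡ false → c ≡ b
        xor-false {true}  {true}  _ = refl
        xor-false {false} {false} _ = refl
        ax : a ≡ col s (others w)
        ax = trans (xor-false e) (sym (proj₁ eq w))

      extend-≈ : ∀ {f} → (∀ w → rowPair w ≡ f w) → s ≈ extend s′ code f
      extend-≈ {f} hf =
          insertAt-≗ refl (insertAt-≗ (trans (cong (col s) pz′) (sym cxz)) (proj₁ eq))
        , border-≗ (lt-irrefl x)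
            (insertAt-≗ (trans (cong (lt s x) pz′) lxz) (lt-from x))
            (insertAt-≗ (trans (cong (λ v → lt s v x) pz′) lzx) (lt-to x))
            (border-≗ (lt-irrefl _)
              (λ j → trans (cong (λ v → lt s v (others j)) pz′) (lt-from z j))
              (λ j → trans (cong (lt s (others j)) pz′) (lt-to z j))
              (proj₁ (proj₂ eq)))
        , border-≗ (adj-supp x x refl)
            (insertAt-≗ (trans (cong (adj s x) pz′) (adj-supp x z cxz)) (λ w → cong proj₁ (hf w)))
            (insertAt-≗ (trans (cong (λ v → adj s v x) pz′) (adj-supp z x (sym cxz)))
              (λ w → trans (adj-sym _ x) (cong proj₁ (hf w))))
            (border-≗ (adj-supp _ _ refl)
              (λ j → trans (cong (λ v → adj s v (others j)) pz′) (cong proj₂ (hf j)))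
              (λ j → trans (cong (adj s (others j)) pz′) (trans (adj-sym _ z) (cong proj₂ (hf j))))
              (proj₂ (proj₂ eq)))
        where
        lzx : lt s z x ≡ false
        lzx = trans (lt-level z x) (≤⇒<ᵇ≡false (<⇒≤ (<ᵇ≡true⇒< (level x) (level z) (trans (sym (lt-level x z)) lxz))))

      code∈params : code ∈ params n
      code∈params = ∈-cartesianProduct⁺ (∈-allFin x) $ ∈-cartesianProduct⁺ (∈-allFin z′) $
        ∈-cartesianProduct⁺ (∈-bools a) $ ∈-cartesianProduct⁺ (∈-upTo⁺ (rank<1+2n lv (level x))) $
        ∈-cartesianProduct⁺ (∈-upTo⁺ (rank<1+2n lv (level z))) (∈-bools bit)

      rows-complete : 5 * opposite (col s) a ≤ 3 * (2 + n) → Any (λ f → ∀ w → rowPair w ≡ f w) (rows s′ code)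
      rows-complete bound with few (col s′) a in e
      ... | true  = choices-complete _≡_ n rowPair∈options
      ... | false with () ← trans (sym e) (T⇒≡true (≤⇒≤ᵇ (subst (λ k → 5 * k ≤ 3 * (2 + n))
                    (trans (sym opposite-others) (#-cong (λ w → cong (_xor a) (proj₁ eq w)))) bound)))

    -- The smaller structure is listed only up to `≈`; the code is therefore formed relative to its
    -- representative `s′`.
    pairCodes-complete : ∀ {L} → 5 * opposite (col s) a ≤ 3 * (2 + n) → Any (restrict others s ≈_) L →
                         Any (s ≈_) (pairCodes L)
    pairCodes-complete bound = Anyₚ.concatMap⁺ _ ∘ Any.map (λ {s′} eq →
      Anyₚ.concatMap⁺ (λ p → map (extend s′ p) (rows s′ p)) (lose (code∈params eq)
        (Anyₚ.map⁺ (Any.map (extend-≈ eq) (rows-complete eq bound)))))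

  -- The recursive cover of all good structures

  NonConstant : ∀ {n} → Str n → Set
  NonConstant s = ∃[ x ] ∃[ z ] (col s x ≡ col s z × lt s x z ≡ true)

  mutual
    cover : ∀ n → List (Str n)
    cover n = base n ++ tallCover n

    -- Kept apart from `base` because this is the part to be shown negligible. It starts at two
    -- vertices, as a pair of one colour on different levels needs two; the recursion goes back to
    -- the full `cover`, since what remains after a deletion may be of either kind.
    tallCover : ∀ n → List (Str n)
    tallCover zero          = []
    tallCover (suc zero)    = []
    tallCover (suc (suc n)) = crude (2 + n) ++ pairCodes (cover n)

  -- With 2b = 3a + d, four times the difference of the two sides is 40ad + 24d².
  crowded⇒unbalanced : ∀ a b N → a + b ≡ N → 3 * N < 5 * b → 100 * (a * b) + N * N ≤ 25 * (N * N)
  crowded⇒unbalanced a b _ refl h = *-cancelˡ-≤ 4 (subst₂ _≤_ (sym lhs) (sym rhs) (m≤m+n _ _ ⟨ ≤-trans ⟩ ≤-reflexive (poly a d)))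
    where
    3a≤2b : 3 * a ≤ 2 * b
    3a≤2b = +-cancelʳ-≤ (3 * b) (3 * a) (2 * b)
      (subst₂ _≤_ (*-distribˡ-+ 3 a b) (*-distribʳ-+ b 2 3) (<⇒≤ h))
    d = 2 * b ∸ 3 * a
    2b≡ : 2 * b ≡ 3 * a + d
    2b≡ = sym (m+[n∸m]≡n 3a≤2b)
    lhs : 4 * (100 * (a * b) + (a + b) * (a + b)) ≡ 200 * (a * (3 * a + d)) + (2 * a + (3 * a + d)) * (2 * a + (3 * a + d))
    lhs = trans (expand a b) (cong (λ c → 200 * (a * c) + (2 * a + c) * (2 * a + c)) 2b≡)
      where
      expand : ∀ a b → 4 * (100 * (a * b) + (a + b) * (a + b)) ≡ 200 * (a * (2 * b)) + (2 * a + 2 * b) * (2 * a + 2 * b)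
      expand = solve-∀
    rhs : 4 * (25 * ((a + b) * (a + b))) ≡ 25 * ((2 * a + (3 * a + d)) * (2 * a + (3 * a + d)))
    rhs = trans (expand a b) (cong (λ c → 25 * ((2 * a + c) * (2 * a + c))) 2b≡)
      where
      expand : ∀ a b → 4 * (25 * ((a + b) * (a + b))) ≡ 25 * ((2 * a + 2 * b) * (2 * a + 2 * b))
      expand = solve-∀
    poly : ∀ a d → 200 * (a * (3 * a + d)) + (2 * a + (3 * a + d)) * (2 * a + (3 * a + d)) + (40 * (a * d) + 24 * (d * d))
                 ≡ 25 * ((2 * a + (3 * a + d)) * (2 * a + (3 * a + d)))
    poly = solve-∀

  opposite-edges : ∀ {n} (c : Fin n → Bool) a → ∃[ k ] (k + opposite c a ≡ n × k * opposite c a ≡ edges c)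
  opposite-edges c false rewrite #-cong (λ i → xor-identityʳ (c i)) =
    # (not ∘ c) , trans (+-comm (# (not ∘ c)) (# c)) (#+#not≡n c) , *-comm (# (not ∘ c)) (# c)
  opposite-edges c true  rewrite #-cong (λ i → trans (xor-comm (c i) true) (true-xor (c i))) =
    # c , #+#not≡n c , refl

  mutual
    cover-complete : ∀ {n} {s : Str n} → Good s → Any (s ≈_) (cover n)
    cover-complete {n} {s} good with any? (λ x → any? (λ z → col s x ≟ᵇ col s z ×-dec lt s x z ≟ᵇ true))
    ... | yes nc = Anyₚ.++⁺ʳ (base n) (tallCover-complete good nc)
    ... | no  c  = Anyₚ.++⁺ˡ (base-complete good c)

    -- The pair that witnesses `NonConstant` is the one deleted. If the other colour is too large
    -- for that, the colouring is unbalanced and the crude list applies.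
    tallCover-complete : ∀ {n} {s : Str n} → Good s → NonConstant s → Any (s ≈_) (tallCover n)
    tallCover-complete {suc zero} {s} good (zero , zero , _ , l)
      with () ← trans (sym l) (trans (Good.lt-level good zero zero) (≤⇒<ᵇ≡false {Good.level good zero} ≤-refl))
    tallCover-complete {suc (suc n)} {s} good (x , z , cxz , lxz)
      with 5 * opposite (col s) (col s x) ≤? 3 * (2 + n)
    ... | yes small = Anyₚ.++⁺ʳ (crude (2 + n)) (pairCodes-complete good cxz lxz small
                        (cover-complete (restrict-good (others good cxz lxz) good)))
    ... | no  large = let k , sum , prod = opposite-edges (col s) (col s x) in
      Anyₚ.++⁺ˡ (crude-complete good (subst (λ e → 100 * e + (2 + n) * (2 + n) ≤ 25 * ((2 + n) * (2 + n))) prod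
        (crowded⇒unbalanced k (opposite (col s) (col s x)) (2 + n) sum (≰⇒> large))))

  -- Posets as structures

  maxOver : ∀ {n} → (Fin n → ℕ) → ℕ
  maxOver {zero}  f = 0
  maxOver {suc n} f = f zero ℕ.⊔ maxOver (f ∘ suc)

  maxOver-upper : ∀ {n} (f : Fin n → ℕ) i → f i ≤ maxOver f
  maxOver-upper f zero    = m≤m⊔n _ _
  maxOver-upper f (suc i) = ≤-trans (maxOver-upper (f ∘ suc) i) (m≤n⊔m _ _)

  -- Restricted to positive values because 0 is also the maximum over the empty set.
  maxOver-attained : ∀ {n} (f : Fin n → ℕ) {k} → maxOver f ≡ suc k → ∃[ i ] f i ≡ suc k
  maxOver-attained {suc n} f e with ⊔-sel (f zero) (maxOver (f ∘ suc))
  ... | inj₁ s = zero , trans (sym s) e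
  ... | inj₂ s = let i , h = maxOver-attained (f ∘ suc) (trans (sym s) e) in suc i , h

  maxOver-cong : ∀ {n} {f g : Fin n → ℕ} → f ≗ g → maxOver f ≡ maxOver g
  maxOver-cong {zero}  h = refl
  maxOver-cong {suc n} h = cong₂ ℕ._⊔_ (h zero) (maxOver-cong (h ∘ suc))

  maxOver-0 : ∀ n → maxOver {n} (λ _ → 0) ≡ 0
  maxOver-0 zero    = refl
  maxOver-0 (suc n) = maxOver-0 n

  ∧⇒ : ∀ {a b} → a ∧ b ≡ true → a ≡ true × b ≡ true
  ∧⇒ {true} {true} _ = refl , refl

  ∨⇒ : ∀ {a b} → a ∨ b ≡ true → a ≡ true ⊎ b ≡ true
  ∨⇒ {true}         _ = inj₁ refl
  ∨⇒ {false} {true} _ = inj₂ refl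

  not-≟⇒≢ : ∀ {n} {i j : Fin n} → not (does (i ≟ j)) ≡ true → i ≢ j
  not-≟⇒≢ {i = i} h refl with () ← trans (sym h) (cong not (dec-true (i ≟ i) refl))

  odd : ℕ → Bool
  odd zero    = false
  odd (suc n) = not (odd n)

  odd-≢-suc : ∀ n → odd n ≢ odd (suc n)
  odd-≢-suc n e with odd n
  odd-≢-suc n () | true
  odd-≢-suc n () | false

  same-parity⇒2+≤ : ∀ {m n} → odd m ≡ odd n → m < n → 2 + m ≤ n
  same-parity⇒2+≤ {m} e m<n with m≤n⇒m<n∨m≡n m<n
  ... | inj₁ h    = h
  ... | inj₂ refl = ⊥-elim (odd-≢-suc m e)

  ∈-patterns-false : ∀ {p q} → p ∨ q ≡ true → (p , q) ∈ patterns false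
  ∈-patterns-false {true}  {true}  _ = here refl
  ∈-patterns-false {true}  {false} _ = there (here refl)
  ∈-patterns-false {false} {true}  _ = there (there (here refl))

  ∈-patterns-true : ∀ {p q} → ¬ (p ≡ true × q ≡ true) → (p , q) ∈ patterns true
  ∈-patterns-true {true}  {true}  h = ⊥-elim (h (refl , refl))
  ∈-patterns-true {false} {false} _ = here refl
  ∈-patterns-true {true}  {false} _ = there (here refl)
  ∈-patterns-true {false} {true}  _ = there (there (here refl))

  -- Levels of equal parity that differ do so by at least 2, which already forces comparability;
  -- `adj` decides the pairs of opposite parity.
  decode : ∀ {n} → Str n → Fin n → Fin n → Bool
  decode s i j = does (i ≟ j) ∨ (lt s i j ∧ (not (col s i xor col s j) ∨ adj s i j))

  rel : ∀ {n} → Str n → Rel n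
  rel s = tabulate (λ i → tabulate (decode s i))

  rel-lookup : ∀ {n} (R : Rel n) {s : Str n} → (∀ i j → lookup (lookup R i) j ≡ decode s i j) → R ≡ rel s
  rel-lookup R h = trans (sym (tabulate∘lookup R))
    (tabulate-cong (λ i → trans (sym (tabulate∘lookup (lookup R i))) (tabulate-cong (h i))))

  decode-≈ : ∀ {n} {s t : Str n} → s ≈ t → ∀ i j → decode s i j ≡ decode t i j
  decode-≈ (hc , hl , ha) i j rewrite hc i | hc j | hl i j | ha i j = refl

  module _ {n : ℕ} (R : Rel n) where

    private
      r : Fin n → Fin n → Bool
      r i j = lookup (lookup R i) j

    below : Fin n → Fin n → Bool
    below u v = r u v ∧ not (does (u ≟ v))

    -- The length of a longest chain below `v`, cut off at `k`. The bound `k` is fuel in place of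
    -- recursion along the order.
    height : ℕ → Fin n → ℕ
    height zero    v = 0
    height (suc k) v = maxOver (λ u → if below u v then suc (height k u) else 0)

    levelOf : Fin n → ℕ
    levelOf = height n

    -- Colour is parity of level, and comparabilities within a colour are erased: in a
    -- (3+1)-avoiding poset the levels restore them.
    toStr : Str n
    toStr = str (odd ∘ levelOf) (λ i j → levelOf i <ᵇ levelOf j)
                (λ i j → (r i j ∨ r j i) ∧ (odd (levelOf i) xor odd (levelOf j)))

    module _ (poset : IsPoset R) where

      private
        r-refl = proj₁ poset
        r-antisym = proj₁ (proj₂ poset)
        r-trans = proj₂ (proj₂ poset)

      below-intro : ∀ {u v} → r u v ≡ true → u ≢ v → below u v ≡ true
      below-intro {u} {v} h ne rewrite h | dec-false (u ≟ v) ne = refl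

      below-elim : ∀ {u v} → below u v ≡ true → r u v ≡ true × u ≢ v
      below-elim h = let a , b = ∧⇒ h in a , not-≟⇒≢ b

      below-irrefl : ∀ u → below u u ≡ false
      below-irrefl u rewrite r-refl u | dec-true (u ≟ u) refl = refl

      below-trans : ∀ {u v w} → below u v ≡ true → below v w ≡ true → below u w ≡ true
      below-trans {u} {v} p q =
        let ruv , u≢v = below-elim p ; rvw , _ = below-elim q in
        below-intro (r-trans _ _ _ ruv rvw) λ { refl → u≢v (r-antisym u v ruv rvw) }

      -- Induction on the fuel: an element `u` below `v` has strictly fewer elements below it, by
      -- transitivity and because `u` is counted for `v` but not for itself.
      height-stable : ∀ k v → # (λ u → below u v) ≤ k → height k v ≡ height (suc k) v
      height-stable zero v h = sym (trans (maxOver-cong none) (maxOver-0 n))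
        where
        none : ∀ u → (if below u v then 1 else 0) ≡ 0
        none u with below u v in e
        ... | false = refl
        ... | true  with () ← <-≤-trans (#-mono-< {p = λ _ → false} (λ _ ()) u refl e) h
      height-stable (suc k) v h = maxOver-cong step
        where
        step : ∀ u → (if below u v then suc (height k u) else 0) ≡ (if below u v then suc (height (suc k) u) else 0)
        step u with below u v in e
        ... | false = refl
        ... | true  = cong suc (height-stable k u (≤-pred (≤-trans
          (#-mono-< (λ i h → below-trans h e) u (below-irrefl u) e) h)))

      levelOf-max : ∀ v → levelOf v ≡ maxOver (λ u → if below u v then suc (levelOf u) else 0)
      levelOf-max v = height-stable n v (#≤n _)

      levelOf-strict : ∀ {u v} → r u v ≡ true → u ≢ v → levelOf u < levelOf v
      levelOf-strict {u} {v} h ne = subst₂ _≤_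
        (cong (λ b → if b then suc (levelOf u) else 0) (below-intro h ne)) (sym (levelOf-max v))
        (maxOver-upper (λ u → if below u v then suc (levelOf u) else 0) u)

      levelOf-pred : ∀ {v k} → levelOf v ≡ suc k → ∃[ u ] (r u v ≡ true × u ≢ v × levelOf u ≡ k)
      levelOf-pred {v} e with maxOver-attained _ (trans (sym (levelOf-max v)) e)
      ... | u , h with below u v in b
      ...   | true = let ruv , ne = below-elim b in u , ruv , ne , suc-injective h

      levelOf-mono : ∀ {u v} → r u v ≡ true → levelOf u ≤ levelOf v
      levelOf-mono {u} {v} h with u ≟ v
      ... | yes refl = ≤-refl
      ... | no  ne   = <⇒≤ (levelOf-strict h ne)

      ≥-level⇒≡ : ∀ {u v} → r u v ≡ true → levelOf v ≤ levelOf u → u ≡ v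
      ≥-level⇒≡ {u} {v} h le with u ≟ v
      ... | yes e  = e
      ... | no  ne = ⊥-elim (<-irrefl refl (<-≤-trans (levelOf-strict h ne) le))

      r-false : ∀ {u v} → levelOf v < levelOf u → ¬ (r u v ≡ true)
      r-false l h = <-irrefl refl (<-≤-trans l (levelOf-mono h))

      module _ (avoids : Avoids3+1 R) where

        -- Descend from `v` through `b` to `a`, one level at a time, so that `w` is no higher than
        -- `a`. If `w` were not below `v` it could be below neither `a` nor `b`, nor above any of
        -- the three, and `a < b < v` with `w` would be a forbidden configuration.
        far : ∀ {w v} → 2 + levelOf w ≤ levelOf v → r w v ≡ true
        far {w} {v} h with levelOf v in ev
        far {w} {v} (s≤s (s≤s lw≤k)) | suc (suc k)
          with b , rbv , b≢v , lb ← levelOf-pred ev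
          with a , rab , a≢b , la ← levelOf-pred lb
          with r w v in e
        ... | true  = refl
        ... | false = ⊥-elim (avoids (a , b , v , w , (rab , a≢b) , (rbv , b≢v) ,
              ( (λ rwa → w≰v (r-trans _ _ _ (r-trans _ _ _ rwa rab) rbv))
              , (λ raw → w≰v (subst (λ u → r u v ≡ true) (≥-level⇒≡ raw (≤-trans lw≤k (≤-reflexive (sym la))))
                                    (r-trans _ _ _ rab rbv)))) ,
              ( (λ rwb → w≰v (r-trans _ _ _ rwb rbv))
              , r-false (≤-trans (s≤s lw≤k) (≤-reflexive (sym lb)))) ,
              ( w≰v
              , r-false (≤-trans (s≤s (m≤n⇒m≤1+n lw≤k)) (≤-reflexive (sym ev))))))
          where
          w≰v : ¬ (r w v ≡ true)
          w≰v h with () ← trans (sym h) e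

        private s = toStr

        adj-above : ∀ {x w} → col s w xor col s x ≡ true → r x w ≡ true → adj s x w ≡ true
        adj-above {x} {w} o h rewrite h | xor-comm (col s x) (col s w) = o

        adj-below : ∀ {x w} → col s w xor col s x ≡ true → r w x ≡ true → adj s x w ≡ true
        adj-below {x} {w} o h rewrite h | xor-comm (col s x) (col s w) | o with r x w
        ... | true  = refl
        ... | false = refl

        adj-elim : ∀ {x w} → adj s x w ≡ true → r x w ≡ true ⊎ r w x ≡ true
        adj-elim h = ∨⇒ (proj₁ (∧⇒ h))

        -- The bit tells whether some `y` with level strictly between is comparable to both `x` and
        -- `z`. If none is, the vertices between see at most one of the two, and every other `w` of
        -- the opposite colour is at least two levels from `x` or from `z`, so `far` applies. If
        -- such a `y` exists, then `x < y < z` is a chain and every `w` of the opposite colour must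
        -- see one of its ends.
        good-pair : ∀ x z → col s x ≡ col s z → lt s x z ≡ true →
          ∃[ b ] ∀ w → col s w xor col s x ≡ true →
          (adj s x w , adj s z w) ∈ patterns (b ∧ (lt s x w ∧ lt s w z))
        good-pair x z cxz lxz
          with any? (λ y → (lt s x y ∧ lt s y z) ≟ᵇ true ×-dec adj s x y ≟ᵇ true ×-dec adj s z y ≟ᵇ true)
        ... | no none = true , pattern-of
          where
          2+x≤z = same-parity⇒2+≤ cxz (<ᵇ≡true⇒< _ _ lxz)
          pattern-of : ∀ w → col s w xor col s x ≡ true →
                       (adj s x w , adj s z w) ∈ patterns (lt s x w ∧ lt s w z)
          pattern-of w o with lt s x w in ex | lt s w z in ez
          ... | true | true  = ∈-patterns-true λ (p , q) → none (w , cong₂ _∧_ ex ez , p , q)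
          ... | false | _ = ∈-patterns-false (trans (cong (adj s x w ∨_)
                 (adj-below (trans (cong (col s w xor_) (sym cxz)) o) (far (≤-trans (s≤s (s≤s w≤x)) 2+x≤z)))) (∨-zeroʳ _))
            where
            w≤x : levelOf w ≤ levelOf x
            w≤x = ≮⇒≥ λ l → case trans (sym ex) (<⇒<ᵇ≡true l) of λ ()
          ... | true | false = ∈-patterns-false (cong (_∨ adj s z w) (adj-above o (far (≤-trans 2+x≤z z≤w))))
            where
            z≤w : levelOf z ≤ levelOf w
            z≤w = ≮⇒≥ λ l → case trans (sym ez) (<⇒<ᵇ≡true l) of λ ()
        ... | yes (y , bet , axy , azy) = false , λ w o → ∈-patterns-false (either w o)
          where
          x<y : levelOf x < levelOf y
          x<y = <ᵇ≡true⇒< _ _ (proj₁ (∧⇒ bet))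
          y<z : levelOf y < levelOf z
          y<z = <ᵇ≡true⇒< _ _ (proj₂ (∧⇒ bet))
          rxy : r x y ≡ true
          rxy with adj-elim axy
          ... | inj₁ h = h
          ... | inj₂ h = ⊥-elim (r-false x<y h)
          ryz : r y z ≡ true
          ryz with adj-elim azy
          ... | inj₁ h = ⊥-elim (r-false y<z h)
          ... | inj₂ h = h
          level≢ : ∀ {u v} → levelOf u < levelOf v → u ≢ v
          level≢ l refl = <-irrefl refl l
          either : ∀ w → col s w xor col s x ≡ true → adj s x w ∨ adj s z w ≡ true
          either w o with 2 + levelOf x ≤? levelOf w | 2 + levelOf w ≤? levelOf z
          ... | yes h | _     = cong (_∨ adj s z w) (adj-above o (far h))
          ... | no _  | yes h = trans (cong (adj s x w ∨_)
                  (adj-below (trans (cong (col s w xor_) (sym cxz)) o) (far h))) (∨-zeroʳ _)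
          ... | no h₁ | no h₂ with adj s x w in ax | adj s z w in az
          ...   | true  | _     = refl
          ...   | false | true  = refl
          -- The failure of both distance tests squeezes `w` onto the level of `y`. Distinct
          -- elements of one level are incomparable, so `w` is incomparable to the whole chain.
          ...   | false | false = ⊥-elim (avoids (x , y , z , w , (rxy , level≢ x<y) , (ryz , level≢ y<z) ,
                    ((λ h → ¬adj ax (adj-below o h)) , (λ h → ¬adj ax (adj-above o h))) ,
                    ((λ h → w≢y (≥-level⇒≡ h y≤w)) , (λ h → w≢y (sym (≥-level⇒≡ h w≤y)))) ,
                    ((λ h → ¬adj az (adj-below oz h)) , (λ h → ¬adj az (adj-above oz h)))))
            where
            ¬adj : ∀ {b} → b ≡ false → b ≡ true → ⊥
            ¬adj refl ()
            oz : col s w xor col s z ≡ true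
            oz = trans (cong (col s w xor_) (sym cxz)) o
            w≤y : levelOf w ≤ levelOf y
            w≤y = ≤-trans (≤-pred (≰⇒> h₁)) x<y
            y≤w : levelOf y ≤ levelOf w
            y≤w = ≤-pred (≤-trans y<z (≤-pred (≰⇒> h₂)))
            w≢y : w ≢ y
            w≢y refl = ¬adj ax axy

        toStr-good : Good toStr
        toStr-good = record
          { level    = levelOf
          ; lt-level = λ _ _ → refl
          ; adj-sym  = λ i j → cong₂ _∧_ (∨-comm (r i j) (r j i)) (xor-comm (col s i) (col s j))
          ; adj-supp = λ i j e → trans (cong ((r i j ∨ r j i) ∧_) (trans (cong (_xor col s j) e) (xor-same (col s j)))) (∧-zeroʳ _)
          ; pair     = good-pair
          }

        -- The order is recovered in three ways: opposite parities from `adj` together with the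
        -- direction of the levels, equal parities on different levels from `far`, and pairs on one
        -- level because they are related only when equal.
        decode-toStr : ∀ i j → r i j ≡ decode toStr i j
        decode-toStr i j with i ≟ j
        ... | yes refl = r-refl i
        ... | no  i≢j with r i j in e
        ...   | true rewrite <⇒<ᵇ≡true (levelOf-strict e i≢j) with odd (levelOf i) xor odd (levelOf j)
        ...     | true  = refl
        ...     | false = refl
        decode-toStr i j | no  i≢j | false with levelOf i <ᵇ levelOf j in l
        ... | false = refl
        ... | true with odd (levelOf i) xor odd (levelOf j) in o | r j i in e′
        ...   | true  | false = refl
        ...   | true  | true  = ⊥-elim (r-false (<ᵇ≡true⇒< _ _ l) e′)
        ...   | false | _ = trans (sym e) (far (same-parity⇒2+≤ (xor-false o) (<ᵇ≡true⇒< _ _ l)))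
          where
          xor-false : ∀ {b c} → b xor c ≡ false → b ≡ c
          xor-false {true}  {true}  _ = refl
          xor-false {false} {false} _ = refl

        -- Two steps down from `v` lead to an element of the same parity on a lower level.
        tall⇒nonConstant : ∀ {v k} → levelOf v ≡ 2 + k → NonConstant toStr
        tall⇒nonConstant {v} {k} ev
          with b , rbv , b≢v , lb ← levelOf-pred ev
          with a , rab , a≢b , la ← levelOf-pred lb
          = a , v , trans (cong odd la) (trans (sym (not-involutive (odd k))) (cong odd (sym ev)))
          , <⇒<ᵇ≡true (subst₂ _<_ (sym la) (sym ev) (s≤s (n≤1+n k)))

        -- With levels 0 and 1 only, the level is its own parity, so the single mode `upward`
        -- suffices. This gives the main term `F n` the coefficient 1, where `base` would give 3.
        poset-covered : Any (λ t → R ≡ rel t) (map (byColour upward) (bips n) ++ tallCover n)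
        poset-covered = Any.map (λ {t} eq → rel-lookup R {t} (λ i j → trans (decode-toStr i j) (decode-≈ {s = toStr} {t} eq i j))) covered
          where
          covered : Any (toStr ≈_) (map (byColour upward) (bips n) ++ tallCover n)
          covered with any? (λ v → 2 ≤? levelOf v)
          ... | no low = Anyₚ.++⁺ˡ (byColour-complete toStr-good upward up)
            where
            two : ∀ {k l} → k < 2 → l < 2 → (k <ᵇ l) ≡ upward (odd k) (odd l)
            two {0} {0} _ _ = refl
            two {0} {1} _ _ = refl
            two {1} {0} _ _ = refl
            two {1} {1} _ _ = refl
            two {suc (suc _)} (s≤s (s≤s ()))
            two {_} {suc (suc _)} _ (s≤s (s≤s ()))
            up : ∀ i j → (levelOf i <ᵇ levelOf j) ≡ upward (odd (levelOf i)) (odd (levelOf j))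
            up i j = two (≰⇒> λ h → low (i , h)) (≰⇒> λ h → low (j , h))
          ... | yes (v , h) = Anyₚ.++⁺ʳ (map (byColour upward) (bips n)) (tallCover-complete toStr-good (tall⇒nonConstant (sym (m+[n∸m]≡n h))))

  count≤ : ∀ {n} {l : List (Rel n)} → Unique l → All (λ R → IsPoset R × Avoids3+1 R) l →
           length l ≤ F n + length (tallCover n)
  count≤ {n} uniq all = ≤-trans
    (distinct-codes⇒length≤ (λ R t → R ≡ rel t) (λ p q → trans p (sym q)) uniq
       (All.map (λ {R} (p , a) → poset-covered R p a) all))
    (≤-reflexive (trans (length-++ (map (byColour upward) (bips n)))
      (cong (_+ length (tallCover n)) (trans (length-map (byColour upward) (bips n)) (length-bips n)))))

  -- Bipartite graphs as posets

  infix 4 _≈ᵇ_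
  _≈ᵇ_ : ∀ {n} → Bip n → Bip n → Set
  (c , g) ≈ᵇ (c′ , g′) = (∀ i → c i ≡ c′ i) × (∀ i j → g i j ≡ g′ i j)

  Upward : ∀ {n} → Bip n → Set
  Upward (c , g) = ∀ i j → not (c i) ∧ c j ≡ false → g i j ≡ false

  upward-edge : ∀ {n} {p : Bip n} → Upward p → ∀ {i j} → proj₂ p i j ≡ true → proj₁ p i ≡ false × proj₁ p j ≡ true
  upward-edge {p = c , g} up {i} {j} e with not (c i) ∧ c j in b
  ... | true  = upward⇒ b
  ... | false with () ← trans (sym e) (up i j b)

  entries-sound : ∀ {b d} → d ∈ entries b → b ≡ false → d ≡ false
  entries-sound (here refl) refl = refl

  bips-upward : ∀ n → All Upward (bips n)
  bips-upward n = Allₚ.concat⁺ (Allₚ.map⁺ (All.universal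
    (λ c → Allₚ.map⁺ (All.map (graphs-upward c) (choices-sound n))) (colourings n)))
    where
    graphs-upward : ∀ c {g} → (∀ i → g i ∈ choices n (λ j → entries (not (c i) ∧ c j))) → Upward (c , g)
    graphs-upward c h i j = entries-sound (All.lookup (choices-sound n) (h i) j)

  bips-complete : ∀ {n} {p : Bip n} → Upward p → Any (p ≈ᵇ_) (bips n)
  bips-complete {p = c , g} up = Anyₚ.concatMap⁺ _ (Any.map
    (λ {c′} hc → Anyₚ.map⁺ (Any.map (hc ,_) (graphs-complete c′ g
      (λ i j e → up i j (trans (cong₂ upward (hc i) (hc j)) e)))))
    (colourings-complete c))

  bips-distinct : ∀ n → AllPairs (λ p q → ¬ p ≈ᵇ q) (bips n)
  bips-distinct n = AllPairsₚ.concat⁺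
    (Allₚ.map⁺ (All.universal (λ c → AllPairsₚ.map⁺ (AllPairs.map (λ ne e → ne (proj₂ e)) (graphs-distinct c))) _))
    (AllPairsₚ.map⁺ (AllPairs.map
      (λ ne → Allₚ.map⁺ (All.universal (λ g → Allₚ.map⁺ (All.universal (λ g′ e → ne (proj₁ e)) _)) _))
      (choices-distinct _≡_ n (λ _ → ((λ ()) ∷ []) ∷ [] ∷ []))))
    where
    entries-distinct : ∀ b → AllPairs (λ x y → ¬ x ≡ y) (entries b)
    entries-distinct true  = ((λ ()) ∷ []) ∷ [] ∷ []
    entries-distinct false = [] ∷ []
    graphs-distinct : ∀ c → AllPairs (λ g g′ → ¬ (∀ i j → g i j ≡ g′ i j)) (graphs {n} c)
    graphs-distinct c = choices-distinct (λ (q q′ : Fin n → Bool) → ∀ j → q j ≡ q′ j) n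
      (λ i → choices-distinct _≡_ n (λ j → entries-distinct (not (c i) ∧ c j)))

  Isolated : ∀ {n} → Bip n → Fin n → Set
  Isolated (c , g) v = ∀ w → g v w ≡ false × g w v ≡ false

  insertIsolated : ∀ {n} → Fin (suc n) → Bool → Bip n → Bip (suc n)
  insertIsolated v a (c , g) = insertAt c v a , border v (λ _ → false) (λ _ → false) false g

  isolatedAt : ∀ {n} → Fin (suc n) → List (Bip (suc n))
  isolatedAt {n} v = concatMap (λ a → map (insertIsolated v a) (bips n)) bools

  isolatedBips : ∀ n → List (Bip (suc n))
  isolatedBips n = concatMap isolatedAt (allFin (suc n))

  length-isolatedBips : ∀ n → length (isolatedBips n) ≤ suc n * (2 * F n)
  length-isolatedBips n = ≤-trans
    (length-concatMap-≤ isolatedAt (λ v → length-concatMap-≤ (λ a → map (insertIsolated v a) (bips n))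
      (λ a → ≤-reflexive (trans (length-map (insertIsolated v a) (bips n)) (length-bips n))) bools) (allFin (suc n)))
    (≤-reflexive (cong (_* (2 * F n)) (length-tabulate {n = suc n} id)))

  isolatedBips-complete : ∀ {n} {p : Bip (suc n)} {v} → Upward p → Isolated p v → Any (p ≈ᵇ_) (isolatedBips n)
  isolatedBips-complete {n} {c , g} {v} up iso = Anyₚ.concatMap⁺ _ (lose (∈-allFin v)
    (Anyₚ.concatMap⁺ (λ a → map (insertIsolated v a) (bips n)) (lose (∈-bools (c v)) (Anyₚ.map⁺ (Any.map
      (λ {q} (hc , hg) → insertAt-≗ {f = c} {v = v} refl hc
        , border-≗ {M = g} {N = proj₂ q} {v = v} (proj₁ (iso v)) (λ j → proj₁ (iso _)) (λ j → proj₂ (iso _)) hg)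
      (bips-complete {p = c ∘ punchIn v , λ i j → g (punchIn v i) (punchIn v j)} (λ i j → up (punchIn v i) (punchIn v j))))))))

  -- The colour `true` is read off from having something strictly below. This recovers the colouring
  -- when no vertex is isolated; an isolated vertex would always be read as `false`.
  toBip : ∀ {n} → Rel n → Bip n
  toBip R = (λ j → does (any? (λ i → below R i j ≟ᵇ true))) , below R

  bipRel : ∀ {n} → Bip n → Rel n
  bipRel p = rel (byColour upward p)

  module _ {n : ℕ} (p : Bip n) (up : Upward p) where
    private
      c = proj₁ p
      g = proj₂ p
      R = bipRel p

    edge-colours : ∀ {i j} → g i j ≡ true → c i ≡ false × c j ≡ true
    edge-colours = upward-edge {p = p} up

    -- In the mode `upward`, vertices of one colour are never on different levels, so the clause of
    -- `decode` for equal colours adds nothing.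
    bipRel-lookup : ∀ i j → lookup (lookup R i) j ≡ does (i ≟ j) ∨ g i j
    bipRel-lookup i j = trans
      (trans (cong (λ v → lookup v j) (lookup∘tabulate (λ i → tabulate (decode (byColour upward p) i)) i)) (lookup∘tabulate _ j))
      (cong (does (i ≟ j) ∨_) core)
      where
      core : upward (c i) (c j) ∧ (not (c i xor c j) ∨ (g i j ∨ g j i)) ≡ g i j
      core with c i in ei | c j in ej
      ... | true  | true  = sym (up i j (cong₂ upward ei ej))
      ... | true  | false = sym (up i j (cong₂ upward ei ej))
      ... | false | false = sym (up i j (cong₂ upward ei ej))
      ... | false | true rewrite up j i (cong₂ upward ej ei) = ∨-identityʳ _

    edge⇒≼ : ∀ {i j} → g i j ≡ true → _≼_ R i j
    edge⇒≼ {i} {j} e = trans (bipRel-lookup i j) (trans (cong (does (i ≟ j) ∨_) e) (∨-zeroʳ _))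

    ≼⇒ : ∀ {i j} → _≼_ R i j → i ≡ j ⊎ g i j ≡ true
    ≼⇒ {i} {j} h with i ≟ j | trans (sym (bipRel-lookup i j)) h
    ... | yes e | _  = inj₁ e
    ... | no  _ | h′ = inj₂ h′

    edge⇒≢ : ∀ {i j} → g i j ≡ true → i ≢ j
    edge⇒≢ e refl with ci , cj ← edge-colours e with () ← trans (sym ci) cj

    edge⇒≺ : ∀ {i j} → g i j ≡ true → _≺_ R i j
    edge⇒≺ e = edge⇒≼ e , edge⇒≢ e

    ≺⇒edge : ∀ {i j} → _≺_ R i j → g i j ≡ true
    ≺⇒edge (h , ne) with ≼⇒ h
    ... | inj₁ e = ⊥-elim (ne e)
    ... | inj₂ e = e

    -- The middle vertex would need both colours. Hence there are no chains of three elements, which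
    -- yields transitivity and avoidance of 3+1 at once.
    no-path : ∀ {i j k} → g i j ≡ true → g j k ≡ true → ⊥
    no-path e e′ with () ← trans (sym (proj₂ (edge-colours e))) (proj₁ (edge-colours e′))

    bipRel-poset : IsPoset R
    bipRel-poset = (λ i → trans (bipRel-lookup i i) (cong (_∨ g i i) (dec-true (i ≟ i) refl))) , antisym , transitive
      where
      antisym : ∀ i j → _≼_ R i j → _≼_ R j i → i ≡ j
      antisym i j h h′ with ≼⇒ h | ≼⇒ h′
      ... | inj₁ e | _       = e
      ... | inj₂ _ | inj₁ e  = sym e
      ... | inj₂ e | inj₂ e′ = ⊥-elim (no-path e e′)
      transitive : ∀ i j k → _≼_ R i j → _≼_ R j k → _≼_ R i k
      transitive i j k h h′ with ≼⇒ h | ≼⇒ h′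
      ... | inj₁ refl | _         = h′
      ... | inj₂ _    | inj₁ refl = h
      ... | inj₂ e    | inj₂ e′   = ⊥-elim (no-path e e′)

    bipRel-avoids : Avoids3+1 R
    bipRel-avoids (_ , _ , _ , _ , xy , yz , _) = no-path (≺⇒edge xy) (≺⇒edge yz)

    module _ (noIso : ¬ ∃ (Isolated p)) where

      neighbour : ∀ v → ∃[ w ] (g v w ≡ true ⊎ g w v ≡ true)
      neighbour v with any? (λ w → (g v w ∨ g w v) ≟ᵇ true)
      ... | yes (w , h) = w , ∨⇒ h
      ... | no  h = ⊥-elim (noIso (v , λ w → ∨-false (λ t → h (w , t))))
        where
        ∨-false : ∀ {a b} → ¬ (a ∨ b ≡ true) → a ≡ false × b ≡ false
        ∨-false {true}          h = ⊥-elim (h refl)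
        ∨-false {false} {true}  h = ⊥-elim (h refl)
        ∨-false {false} {false} h = refl , refl

      upper⇒edge : ∀ {v} → c v ≡ true → ∃[ w ] g w v ≡ true
      upper⇒edge {v} cv with neighbour v
      ... | w , inj₂ e = w , e
      ... | w , inj₁ e with () ← trans (sym cv) (proj₁ (edge-colours e))

      lower⇒edge : ∀ {v} → c v ≡ false → ∃[ w ] g v w ≡ true
      lower⇒edge {v} cv with neighbour v
      ... | w , inj₁ e = w , e
      ... | w , inj₂ e with () ← trans (sym cv) (proj₂ (edge-colours e))

      -- The rank is the colour read as 0 or 1. Without isolated vertices, minimal elements are
      -- coloured `false` and maximal ones `true`, and every upper vertex is joined to one of rank
      -- 0.
      bipRel-strong : StronglyGraded R
      bipRel-strong = (⟦_⟧ ∘ c) , ((covers , grounded) ,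
        (λ a b ma mb → trans (minimal a ma) (sym (minimal b mb))) ,
        (λ a b ma mb → trans (maximal a ma) (sym (maximal b mb))))
        where
        covers : ∀ a b → Covers R a b → ⟦ c b ⟧ ≡ suc ⟦ c a ⟧
        covers a b (ab , _) with ca , cb ← edge-colours (≺⇒edge ab) rewrite ca | cb = refl
        minimal : ∀ a → Minimal R a → ⟦ c a ⟧ ≡ 0
        minimal a m with c a in ca
        ... | false = refl
        ... | true  = let w , e = upper⇒edge ca in ⊥-elim (m (w , edge⇒≺ e))
        maximal : ∀ a → Maximal R a → ⟦ c a ⟧ ≡ 1
        maximal a m with c a in ca
        ... | true  = refl
        ... | false = let w , e = lower⇒edge ca in ⊥-elim (m (w , edge⇒≺ e))
        grounded : ∀ a → ∃[ b ] (Connected R a b × ⟦ c b ⟧ ≡ 0)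
        grounded a with c a in ca
        ... | false = a , here , cong ⟦_⟧ ca
        ... | true  = let w , e = upper⇒edge ca in
                      w , stepD (edge⇒≼ e) here , cong ⟦_⟧ (proj₁ (edge-colours e))

      below-bipRel : ∀ i j → below R i j ≡ g i j
      below-bipRel i j with below R i j in b | g i j in e
      ... | true  | true  = refl
      ... | false | false = refl
      ... | true  | false = let rij , i≢j = below-elim R bipRel-poset b in trans (sym (≺⇒edge (rij , i≢j))) e
      ... | false | true  = trans (sym b) (below-intro R bipRel-poset (edge⇒≼ e) (edge⇒≢ e))

      toBip-bipRel : p ≈ᵇ toBip R
      toBip-bipRel = colour , λ i j → sym (below-bipRel i j)
        where
        colour : ∀ j → c j ≡ does (any? (λ i → below R i j ≟ᵇ true))
        colour j with c j in cj
        ... | true  = let w , e = upper⇒edge cj in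
                      sym (dec-true (any? (λ i → below R i j ≟ᵇ true)) (w , trans (below-bipRel w j) e))
        ... | false = sym (dec-false (any? (λ i → below R i j ≟ᵇ true))
          λ (w , b) → case trans (sym cj) (proj₂ (edge-colours (trans (sym (below-bipRel w j)) b))) of λ ())

  -- Each coloured graph is coded either by the image under `toBip` of its own poset, which occurs
  -- in `l`, or, when some vertex is isolated, by an entry of `isolatedBips`.
  bips≤count : ∀ n (l : List (Rel (suc n))) →
    (∀ R → IsPoset R × StronglyGraded R × Avoids3+1 R → R ∈ l) →
    F (suc n) ≤ length l + suc n * (2 * F n)
  bips≤count n l complete = begin
    F (suc n)                                       ≡⟨ length-bips (suc n) ⟨
    length (bips (suc n))                           ≤⟨ distinct-codes⇒length≤ _≈ᵇ_ joint (bips-distinct (suc n)) (All.map coded (bips-upward (suc n))) ⟩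
    length (map toBip l ++ isolatedBips n)          ≡⟨ length-++ (map toBip l) ⟩
    length (map toBip l) + length (isolatedBips n)  ≤⟨ +-mono-≤ (≤-reflexive (length-map toBip l)) (length-isolatedBips n) ⟩
    length l + suc n * (2 * F n)                    ∎
    where
    open ≤-Reasoning
    joint : ∀ {p q y : Bip (suc n)} → p ≈ᵇ y → q ≈ᵇ y → p ≈ᵇ q
    joint (h , k) (h′ , k′) = (λ i → trans (h i) (sym (h′ i))) , λ i j → trans (k i j) (sym (k′ i j))
    coded : ∀ {p} → Upward p → Any (p ≈ᵇ_) (map toBip l ++ isolatedBips n)
    coded {p@(c , g)} up with any? (λ v → all? (λ w → g v w ≟ᵇ false ×-dec g w v ≟ᵇ false))
    ... | yes (v , iso) = Anyₚ.++⁺ʳ (map toBip l) (isolatedBips-complete up iso)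
    ... | no  noIso     = Anyₚ.++⁺ˡ (Anyₚ.map⁺ (lose
      (complete (bipRel p) (bipRel-poset p up , bipRel-strong p up noIso , bipRel-avoids p up))
      (toBip-bipRel p up noIso)))

  -- Growth

  Eventually : (ℕ → Set) → Set
  Eventually P = ∃[ N ] ∀ n → N ≤ n → P n

  ev-map : ∀ {P Q : ℕ → Set} → (∀ n → P n → Q n) → Eventually P → Eventually Q
  ev-map f (N , h) = N , λ n le → f n (h n le)

  ev-zip : ∀ {P Q R : ℕ → Set} → (∀ n → P n → Q n → R n) → Eventually P → Eventually Q → Eventually R
  ev-zip f (N , h) (M , k) = N ℕ.⊔ M , λ n le → f n (h n (≤-trans (m≤m⊔n N M) le)) (k n (≤-trans (m≤n⊔m N M) le))

  ev-≥ : ∀ k → Eventually (k ≤_)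
  ev-≥ k = k , λ _ le → le

  ev-pred : ∀ {P : ℕ → Set} k → Eventually (λ n → P (k + n)) → Eventually P
  ev-pred {P} k (N , h) = k + N , λ n le →
    subst P (m+[n∸m]≡n (≤-trans (m≤m+n k N) le)) (h (n ∸ k) (≤-trans (≤-reflexive (sym (m+n∸m≡n k N))) (∸-monoˡ-≤ k le)))

  ev-suc : ∀ {P : ℕ → Set} k → Eventually P → Eventually (λ n → P (k + n))
  ev-suc k (N , h) = N , λ n le → h (k + n) (≤-trans le (m≤n+m n k))

  infix 4 _≪_
  -- Little-o in division-free form, `K` standing for the reciprocal of ε.
  _≪_ : (ℕ → ℕ) → (ℕ → ℕ) → Set
  a ≪ b = ∀ K → Eventually (λ n → K * a n ≤ b n)

  ^-distribʳ-* : ∀ m n k → (m * n) ^ k ≡ m ^ k * n ^ k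
  ^-distribʳ-* m n zero    = refl
  ^-distribʳ-* m n (suc k) = trans (cong (m * n *_) (^-distribʳ-* m n k)) ([m*n]*[o*p]≡[m*o]*[n*p] m n (m ^ k) (n ^ k))

  ^-swap : ∀ m a b → (m ^ a) ^ b ≡ (m ^ b) ^ a
  ^-swap m a b = trans (^-*-assoc m a b) (trans (cong (m ^_) (*-comm a b)) (sym (^-*-assoc m b a)))

  ^-cancelˡ-≤ : ∀ e .{{_ : NonZero e}} {m n} → m ^ e ≤ n ^ e → m ≤ n
  ^-cancelˡ-≤ e h = ≮⇒≥ λ n<m → <-irrefl refl (<-≤-trans (^-monoˡ-< e n<m) h)

  n<2^n : ∀ n → n < 2 ^ n
  n<2^n zero    = s≤s z≤n
  n<2^n (suc n) = +-mono-≤ (m^n>0 2 n) (≤-trans (n<2^n n) (≤-reflexive (sym (+-identityʳ _))))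

  m≤m^n : ∀ m n .{{_ : NonZero n}} → m ≤ m ^ n
  m≤m^n zero      n       = z≤n
  m≤m^n m@(suc _) (suc n) = m≤m*n m (m ^ n) {{m^n≢0 m n}}

  -- From `q = 4 * A` on: there A(4A + 1) ≤ (A + 1)^4 ≤ (2^A)^4, and afterwards the left side at
  -- most doubles with each step.
  linear-≪-2^ : ∀ A → Eventually (λ q → A * suc q ≤ 2 ^ q)
  linear-≪-2^ A = 4 * A , λ q le → subst (λ q → A * suc q ≤ 2 ^ q) (m+[n∸m]≡n le) (from (q ∸ 4 * A))
    where
    start : A * suc (4 * A) ≤ 2 ^ (4 * A)
    start = begin
      A * suc (4 * A)                                    ≤⟨ m≤m+n _ _ ⟩
      A * suc (4 * A) + (A * A * (A * A + 4 * A + 2) + 3 * A + 1) ≡⟨ poly A ⟩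
      suc A ^ 4                                          ≤⟨ ^-monoˡ-≤ 4 (n<2^n A) ⟩
      (2 ^ A) ^ 4                                        ≡⟨ trans (^-*-assoc 2 A 4) (cong (2 ^_) (*-comm A 4)) ⟩
      2 ^ (4 * A)                                        ∎
      where
      open ≤-Reasoning
      poly : ∀ A → A * suc (4 * A) + (A * A * (A * A + 4 * A + 2) + 3 * A + 1) ≡ suc A * (suc A * (suc A * (suc A * 1)))
      poly = solve-∀
    from : ∀ k → A * suc (4 * A + k) ≤ 2 ^ (4 * A + k)
    from zero    = subst (λ q → A * suc q ≤ 2 ^ q) (sym (+-identityʳ (4 * A))) start
    from (suc k) = subst (λ q → A * suc q ≤ 2 ^ q) (sym (+-suc (4 * A) k)) (begin
      A * suc (suc q)         ≤⟨ *-monoʳ-≤ A (s≤s (m≤n+m (suc q) q)) ⟩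
      A * (suc q + suc q)     ≡⟨ *-distribˡ-+ A (suc q) (suc q) ⟩
      A * suc q + A * suc q   ≤⟨ +-mono-≤ (from k) (≤-trans (from k) (m≤m+n _ 0)) ⟩
      2 ^ suc q               ∎)
      where
      open ≤-Reasoning
      q = 4 * A + k

  -- With q = n / d one has n ≤ d(q + 1), so the linear bound with factor A d gives A n ≤ 2^q; the
  -- d-th power of this is at most 2^n.
  poly-≪-2^ : ∀ A d .{{_ : NonZero d}} → Eventually (λ n → (A * n) ^ d ≤ 2 ^ n)
  poly-≪-2^ A d with Q , h ← linear-≪-2^ (A * d) = Q * d , λ n le →
    let q = n / d
        Q≤q : Q ≤ q
        Q≤q = ≤-trans (≤-reflexive (sym (m*n/n≡m Q d))) (/-monoˡ-≤ d le)
        n≤ : n ≤ d * suc q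
        n≤ = ≤-trans (≤-reflexive (m≡m%n+[m/n]*n n d)) (≤-trans (+-monoˡ-≤ (q * d) (<⇒≤ (m%n<n n d))) (≤-reflexive (*-comm (suc q) d)))
        An≤ : A * n ≤ 2 ^ q
        An≤ = ≤-trans (*-monoʳ-≤ A n≤) (≤-trans (≤-reflexive (sym (*-assoc A d (suc q)))) (h q Q≤q))
    in ≤-trans (^-monoˡ-≤ d An≤) (≤-trans (≤-reflexive (^-*-assoc 2 q d)) (^-monoʳ-≤ 2 (m/n*n≤m n d)))

  -- The hypotheses say x ≤ 2^(N/(e+1)) and y ≤ 2^(Ne/(e+1)) without roots: a subexponential `x`
  -- fits into the gap left by `y`.
  absorb : ∀ e {x y N} → x ^ suc e ≤ 2 ^ N → y ^ suc e ≤ (2 ^ N) ^ e → x * y ≤ 2 ^ N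
  absorb e {x} {y} {N} hx hy = ^-cancelˡ-≤ (suc e)
    (≤-trans (≤-reflexive (^-distribʳ-* x y (suc e))) (*-mono-≤ hx hy))

  -- 3^5t ≤ 27^N and 27^5 < 2^24.
  3^≤2^ : ∀ t N → 5 * t ≤ 3 * N → (3 ^ t) ^ 25 ≤ (2 ^ N) ^ 24
  3^≤2^ t N h = begin
    (3 ^ t) ^ 25        ≡⟨ ^-*-assoc (3 ^ t) 5 5 ⟨
    ((3 ^ t) ^ 5) ^ 5   ≤⟨ ^-monoˡ-≤ 5 lem ⟩
    (27 ^ N) ^ 5        ≡⟨ ^-swap 27 N 5 ⟩
    (27 ^ 5) ^ N        ≤⟨ ^-monoˡ-≤ N (≤ᵇ⇒≤ (27 ^ 5) (2 ^ 24) _) ⟩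
    (2 ^ 24) ^ N        ≡⟨ ^-swap 2 24 N ⟩
    (2 ^ N) ^ 24        ∎
    where
    open ≤-Reasoning
    lem : (3 ^ t) ^ 5 ≤ 27 ^ N
    lem = ≤-trans (≤-reflexive (trans (^-*-assoc 3 t 5) (cong (3 ^_) (*-comm t 5))))
            (≤-trans (^-monoʳ-≤ 3 h) (≤-reflexive (sym (^-*-assoc 3 3 N))))

  -- After raising to the power `e`, the exponents of 2^m and 2^t differ by at least n² up to the
  -- constant `c`; that gap pays for `Q`.
  2^-dominates : ∀ e c .{{_ : NonZero e}} {Q m t n} → e * m + n * n ≤ c * (n * n) → c * (n * n) ≤ e * t + c →
    Q ^ e * 2 ^ c ≤ 2 ^ (n * n) → 2 ^ m * Q ≤ 2 ^ t
  2^-dominates e c {Q} {m} {t} {n} h₁ h₂ h₃ = ^-cancelˡ-≤ e (*-cancelʳ-≤ _ _ (2 ^ c) {{m^n≢0 2 c}} (begin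
    (2 ^ m * Q) ^ e * 2 ^ c          ≡⟨ cong (_* 2 ^ c) (^-distribʳ-* (2 ^ m) Q e) ⟩
    (2 ^ m) ^ e * Q ^ e * 2 ^ c      ≡⟨ *-assoc ((2 ^ m) ^ e) (Q ^ e) (2 ^ c) ⟩
    (2 ^ m) ^ e * (Q ^ e * 2 ^ c)    ≤⟨ *-mono-≤ (≤-reflexive (trans (^-*-assoc 2 m e) (cong (2 ^_) (*-comm m e)))) h₃ ⟩
    2 ^ (e * m) * 2 ^ (n * n)        ≡⟨ ^-distribˡ-+-* 2 (e * m) (n * n) ⟨
    2 ^ (e * m + n * n)              ≤⟨ ^-monoʳ-≤ 2 (≤-trans h₁ h₂) ⟩
    2 ^ (e * t + c)                  ≡⟨ ^-distribˡ-+-* 2 (e * t) c ⟩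
    2 ^ (e * t) * 2 ^ c              ≡⟨ cong (_* 2 ^ c) (trans (cong (2 ^_) (*-comm e t)) (sym (^-*-assoc 2 t e))) ⟩
    (2 ^ t) ^ e * 2 ^ c              ∎))
    where open ≤-Reasoning

  -- The factor 2^n allows for summing over all colourings. Twice the whole factor is at most
  -- (12Kn)^n, where 12 collects 2 from 2^n, 3 from 2n + 1 ≤ 3n and 2 from the doubling; its e-th
  -- power is at most 2^(n²) once (12Kn)^e ≤ 2^n.
  crude-dominated : ∀ e c .{{_ : NonZero e}} → c ≤ e → ∀ K → Eventually (λ n → ∀ m t →
    e * m + n * n ≤ c * (n * n) → c * (n * n) ≤ e * t + c →
    2 ^ m * (K * (2 ^ n * suc (n + n) ^ n)) ≤ 2 ^ t)
  crude-dominated e c c≤e K = ev-zip (λ n 1≤n h m t h₁ h₂ → 2^-dominates e c {m = m} {t} {n} h₁ h₂ (big n 1≤n h))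
    (ev-≥ 1) (poly-≪-2^ (12 * K) e)
    where
    open ≤-Reasoning
    big : ∀ n → 1 ≤ n → (12 * K * n) ^ e ≤ 2 ^ n → (K * (2 ^ n * suc (n + n) ^ n)) ^ e * 2 ^ c ≤ 2 ^ (n * n)
    big n@(suc _) 1≤n h = begin
      Q ^ e * 2 ^ c                ≤⟨ *-monoʳ-≤ (Q ^ e) (^-monoʳ-≤ 2 c≤e) ⟩
      Q ^ e * 2 ^ e                ≡⟨ ^-distribʳ-* Q 2 e ⟨
      (Q * 2) ^ e                  ≤⟨ ^-monoˡ-≤ e Q2≤ ⟩
      ((12 * K * n) ^ n) ^ e       ≡⟨ ^-swap (12 * K * n) n e ⟩
      ((12 * K * n) ^ e) ^ n       ≤⟨ ^-monoˡ-≤ n h ⟩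
      (2 ^ n) ^ n                  ≡⟨ ^-*-assoc 2 n n ⟩
      2 ^ (n * n)                  ∎
      where
      Q = K * (2 ^ n * suc (n + n) ^ n)
      3n : suc (n + n) ≤ 3 * n
      3n = ≤-trans (+-monoˡ-≤ (n + n) 1≤n) (≤-reflexive (cong (λ k → n + (n + k)) (sym (+-identityʳ n))))
      Q2≤ : Q * 2 ≤ (12 * K * n) ^ n
      Q2≤ = begin
        Q * 2                                   ≤⟨ *-mono-≤ (*-mono-≤ (m≤m^n K n) (*-monoʳ-≤ (2 ^ n) (^-monoˡ-≤ n 3n))) (m≤m^n 2 n) ⟩
        K ^ n * (2 ^ n * (3 * n) ^ n) * 2 ^ n   ≡⟨ cong (λ z → K ^ n * z * 2 ^ n) (^-distribʳ-* 2 (3 * n) n) ⟨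
        K ^ n * (2 * (3 * n)) ^ n * 2 ^ n       ≡⟨ cong (_* 2 ^ n) (^-distribʳ-* K (2 * (3 * n)) n) ⟨
        (K * (2 * (3 * n))) ^ n * 2 ^ n         ≡⟨ ^-distribʳ-* (K * (2 * (3 * n))) 2 n ⟨
        (K * (2 * (3 * n)) * 2) ^ n             ≡⟨ cong (_^ n) (rearrange K n) ⟩
        (12 * K * n) ^ n                        ∎
        where
        rearrange : ∀ K n → K * (2 * (3 * n)) * 2 ≡ 12 * K * n
        rearrange = solve-∀

  -- `absorb` with the polynomial factor as `x` and 3^t as `y`. The additional factor 2 turns 2^N
  -- into 2^(N-1), the growth available from `F-suc-suc` at N = n + 2.
  pair-dominated : ∀ e → (∀ t N → 5 * t ≤ 3 * N → (3 ^ t) ^ suc e ≤ (2 ^ N) ^ e) →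
    ∀ K → Eventually (λ N → ∀ q t → q ≤ (2 * N) ^ 4 → 5 * t ≤ 3 * N → 2 * (K * (q * 3 ^ t)) ≤ 2 ^ N)
  pair-dominated e h3 K = ev-map dominated (poly-≪-2^ (4 * K) (4 * suc e))
    where
    open ≤-Reasoning
    regroup : ∀ a k b c → a * (k * (b * c)) ≡ a * k * b * c
    regroup = solve-∀
    regroup′ : ∀ k m → 2 * k * (2 * m) ≡ 4 * k * m
    regroup′ = solve-∀
    dominated : ∀ N → (4 * K * N) ^ (4 * suc e) ≤ 2 ^ N →
      ∀ q t → q ≤ (2 * N) ^ 4 → 5 * t ≤ 3 * N → 2 * (K * (q * 3 ^ t)) ≤ 2 ^ N
    dominated N h q t hq ht = ≤-trans (≤-reflexive (regroup 2 K q (3 ^ t))) (absorb e {2 * K * q} {3 ^ t} {N} poly (h3 t N ht))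
      where
      poly : (2 * K * q) ^ suc e ≤ 2 ^ N
      poly = begin
        (2 * K * q) ^ suc e                       ≤⟨ ^-monoˡ-≤ (suc e) (*-mono-≤ (m≤m^n (2 * K) 4) hq) ⟩
        ((2 * K) ^ 4 * (2 * N) ^ 4) ^ suc e       ≡⟨ cong (_^ suc e) (^-distribʳ-* (2 * K) (2 * N) 4) ⟨
        ((2 * K * (2 * N)) ^ 4) ^ suc e           ≡⟨ ^-*-assoc (2 * K * (2 * N)) 4 (suc e) ⟩
        (2 * K * (2 * N)) ^ (4 * suc e)           ≡⟨ cong (_^ (4 * suc e)) (regroup′ K N) ⟩
        (4 * K * N) ^ (4 * suc e)                 ≤⟨ h ⟩
        2 ^ N                                     ∎

  -- A recurrence that makes a remainder negligible

  sumTo : ℕ → (ℕ → ℕ) → ℕ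
  sumTo zero    f = f 0
  sumTo (suc n) f = sumTo n f + f (suc n)

  sumTo-≥ : ∀ n f {i} → i ≤ n → f i ≤ sumTo n f
  sumTo-≥ zero    f z≤n = ≤-refl
  sumTo-≥ (suc n) f h with m≤n⇒m<n∨m≡n h
  ... | inj₁ (s≤s l) = m≤n⇒m≤n+o (f (suc n)) (sumTo-≥ n f l)
  ... | inj₂ refl    = m≤n+m (f (suc n)) (sumTo n f)

  module _ {f total rest c p : ℕ → ℕ}
           (f≥1 : ∀ n → 1 ≤ f n)
           (total≤ : ∀ n → total n ≤ 3 * f n + rest n)
           (rest≤ : ∀ n → rest (2 + n) ≤ c (2 + n) + total n * p n)
           (c≪f : c ≪ f)
           (p-≪ : ∀ K → Eventually (λ n → K * (f n * p n) ≤ f (2 + n))) where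

    open ≤-Reasoning

    -- Strong induction: for large n the recursive term returns at most half of `A * f`, and the
    -- remaining terms are at most 4 `f`, which is within the other half as A ≥ 8.
    total-O : ∃[ A ] ∀ n → total n ≤ A * f n
    total-O with N , h ← ev-zip (λ n → _,_) (ev-suc 2 (c≪f 1)) (p-≪ 2) = A , <-rec _ bound
      where
      -- The sum covers all n ≤ 2 + N, where `f n ≥ 1`; the 8 is twice the coefficient 3 + 1 of `f`
      -- in the recurrence.
      A = 8 + sumTo (2 + N) total
      bound : ∀ n → (∀ {m} → m < n → total m ≤ A * f m) → total n ≤ A * f n
      bound n rec with n ≤? 2 + N
      ... | yes n≤ = ≤-trans (≤-trans (sumTo-≥ (2 + N) total n≤) (m≤n+m _ 8))
                             (≤-trans (≤-reflexive (sym (*-identityʳ A))) (*-monoʳ-≤ A (f≥1 n)))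
      bound zero          rec | no n≰ with () ← n≰ z≤n
      bound (suc zero)    rec | no n≰ with () ← n≰ (s≤s z≤n)
      bound (suc (suc n)) rec | no n≰ with hc , hp ← h n (<⇒≤ (≤-pred (≤-pred (≰⇒> n≰)))) = *-cancelˡ-≤ 2 (begin
        2 * total (2 + n)                                       ≤⟨ *-monoʳ-≤ 2 (≤-trans (total≤ (2 + n)) (+-monoʳ-≤ (3 * f (2 + n)) (rest≤ n))) ⟩
        2 * (3 * f (2 + n) + (c (2 + n) + total n * p n))       ≤⟨ *-monoʳ-≤ 2 (+-monoʳ-≤ (3 * f (2 + n)) (+-mono-≤ hc′ (*-monoˡ-≤ (p n) (rec (s≤s (n≤1+n n)))))) ⟩
        2 * (3 * f (2 + n) + (f (2 + n) + A * f n * p n))       ≡⟨ regroup A (f (2 + n)) (f n) (p n) ⟩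
        8 * f (2 + n) + A * (2 * (f n * p n))                   ≤⟨ +-mono-≤ (*-monoˡ-≤ (f (2 + n)) (m≤m+n 8 (sumTo (2 + N) total))) (*-monoʳ-≤ A hp) ⟩
        A * f (2 + n) + A * f (2 + n)                           ≡⟨ cong (A * f (2 + n) +_) (sym (+-identityʳ (A * f (2 + n)))) ⟩
        2 * (A * f (2 + n))                                     ∎)
        where
        hc′ : c (2 + n) ≤ f (2 + n)
        hc′ = ≤-trans (≤-reflexive (sym (*-identityˡ _))) hc
        regroup : ∀ a f g p → 2 * (3 * f + (f + a * g * p)) ≡ 8 * f + a * (2 * (g * p))
        regroup = solve-∀

    -- Once `total` is known to be O(`f`), both parts of `rest` are o(`f`); each is allotted half of
    -- the bound.
    remainder-≪ : rest ≪ f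
    remainder-≪ K with A , total≤Af ← total-O =
      ev-pred 2 (ev-zip dominated (ev-suc 2 (c≪f (2 * K))) (p-≪ (2 * (K * A))))
      where
      regroup : ∀ K c a g p → 2 * (K * (c + a * g * p)) ≡ 2 * K * c + 2 * (K * a) * (g * p)
      regroup = solve-∀
      dominated : ∀ n → 2 * K * c (2 + n) ≤ f (2 + n) → 2 * (K * A) * (f n * p n) ≤ f (2 + n) →
                  K * rest (2 + n) ≤ f (2 + n)
      dominated n hc hp = *-cancelˡ-≤ 2 (begin
        2 * (K * rest (2 + n))                                  ≤⟨ *-monoʳ-≤ 2 (*-monoʳ-≤ K (rest≤ n)) ⟩
        2 * (K * (c (2 + n) + total n * p n))                   ≤⟨ *-monoʳ-≤ 2 (*-monoʳ-≤ K (+-monoʳ-≤ _ (*-monoˡ-≤ (p n) (total≤Af n)))) ⟩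
        2 * (K * (c (2 + n) + A * f n * p n))                   ≡⟨ regroup K (c (2 + n)) A (f n) (p n) ⟩
        2 * K * c (2 + n) + 2 * (K * A) * (f n * p n)           ≤⟨ +-mono-≤ hc (≤-trans hp (m≤m+n _ 0)) ⟩
        2 * f (2 + n)                                           ∎)

  -- Asymptotic equivalence of natural sequences

  ∣-∣≤ : ∀ {a b e} → a ≤ b + e → b ≤ a + e → ∣ a - b ∣ ≤ e
  ∣-∣≤ {a} {b} {e} h k with ≤-total a b
  ... | inj₁ a≤b = ≤-trans (≤-reflexive (m≤n⇒∣m-n∣≡n∸m a≤b)) (≤-trans (∸-monoˡ-≤ a k) (≤-reflexive (m+n∸m≡n a e)))
  ... | inj₂ b≤a = ≤-trans (≤-reflexive (trans (∣-∣-comm a b) (m≤n⇒∣m-n∣≡n∸m b≤a)))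
                     (≤-trans (∸-monoˡ-≤ b h) (≤-reflexive (m+n∸m≡n b e)))

  infix 4 _∼ℕ_
  _∼ℕ_ : (ℕ → ℕ) → (ℕ → ℕ) → Set
  a ∼ℕ b = (λ n → ∣ a n - b n ∣) ≪ b

  squeeze : ∀ {f g w e d : ℕ → ℕ} →
    Eventually (λ n → f n ≤ g n + e n) → (∀ n → g n ≤ w n) → (∀ n → w n ≤ f n + d n) →
    e ≪ f → d ≪ f → (g ∼ℕ w) × (w ∼ℕ f) × (g ∼ℕ f)
  squeeze {f} {g} {w} {e} {d} f≤ g≤w w≤ e≪f d≪f = gw , wf , gf
    where
    open ≤-Reasoning
    error-≪ : ∀ K → Eventually (λ n → K * (e n + d n) ≤ f n)
    error-≪ K = ev-zip (λ n he hd → *-cancelˡ-≤ 2 (begin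
        2 * (K * (e n + d n))              ≡⟨ regroup K (e n) (d n) ⟩
        2 * K * e n + 2 * K * d n          ≤⟨ +-mono-≤ he (≤-trans hd (m≤m+n _ 0)) ⟩
        2 * f n                            ∎))
      (e≪f (2 * K)) (d≪f (2 * K))
      where
      regroup : ∀ K e d → 2 * (K * (e + d)) ≡ 2 * K * e + 2 * K * d
      regroup = solve-∀
    f≤w+ : ∀ n → f n ≤ g n + e n → f n ≤ w n + (e n + d n)
    f≤w+ n h = ≤-trans h (+-mono-≤ (g≤w n) (m≤m+n (e n) (d n)))
    w≤f+ : ∀ n → w n ≤ f n + (e n + d n)
    w≤f+ n = ≤-trans (w≤ n) (+-monoʳ-≤ (f n) (m≤n+m (d n) (e n)))
    wf : w ∼ℕ f
    wf K = ev-zip (λ n hf he → ≤-trans (*-monoʳ-≤ K (∣-∣≤ (w≤f+ n) (f≤w+ n hf))) he) f≤ (error-≪ K)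
    gf : g ∼ℕ f
    gf K = ev-zip (λ n hf he → ≤-trans (*-monoʳ-≤ K (∣-∣≤ (≤-trans (g≤w n) (w≤f+ n))
             (≤-trans hf (+-monoʳ-≤ (g n) (m≤m+n (e n) (d n)))))) he) f≤ (error-≪ K)
    gw : g ∼ℕ w
    -- The error is small relative to `f`, but here it has to be measured against `w`. Since `f`
    -- exceeds `w` by at most one error, starting from `suc K` and cancelling one copy is enough.
    gw K = ev-zip (λ n hf he → ≤-trans
        (*-monoʳ-≤ K (∣-∣≤ {g n} {w n} (≤-trans (g≤w n) (m≤m+n (w n) _))
          (≤-trans (w≤ n) (≤-trans (+-monoˡ-≤ (d n) hf) (≤-reflexive (+-assoc (g n) (e n) (d n)))))))
        (+-cancelˡ-≤ (e n + d n) _ _ (≤-trans he (≤-trans (f≤w+ n hf) (≤-reflexive (+-comm (w n) _))))))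
      f≤ (error-≪ (suc K))

  -- Evaluating `F` by binomial coefficients

  ∑-++ : {A : Set} (f : A → ℕ) → ∀ xs ys → ∑ (xs ++ ys) f ≡ ∑ xs f + ∑ ys f
  ∑-++ f xs ys = trans (cong sum (map-++ f xs ys)) (sum-++ (map f xs) (map f ys))

  ∑-map : {A B : Set} (f : B → ℕ) (g : A → B) → ∀ xs → ∑ (map g xs) f ≡ ∑ xs (f ∘ g)
  ∑-map f g []       = refl
  ∑-map f g (x ∷ xs) = cong (f (g x) +_) (∑-map f g xs)

  ∑-+ : {A : Set} (f g : A → ℕ) → ∀ xs → ∑ xs (λ x → f x + g x) ≡ ∑ xs f + ∑ xs g
  ∑-+ f g []       = refl
  ∑-+ f g (x ∷ xs) = trans (cong (f x + g x +_) (∑-+ f g xs)) (+-interchange (f x) (g x) (∑ xs f) (∑ xs g))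

  ∑-colourings-suc : ∀ n (h : (Fin (suc n) → Bool) → ℕ) →
    ∑ (colourings (suc n)) h ≡ ∑ (colourings n) (λ c → h (true ◂ c) + h (false ◂ c))
  ∑-colourings-suc n h = begin
    ∑ (map (true ◂_) cs ++ map (false ◂_) cs ++ []) h      ≡⟨ ∑-++ h (map (true ◂_) cs) (map (false ◂_) cs ++ []) ⟩
    _ + ∑ (map (false ◂_) cs ++ []) h                      ≡⟨ cong (∑ (map (true ◂_) cs) h +_) (trans (∑-++ h (map (false ◂_) cs) []) (+-identityʳ _)) ⟩
    _ + ∑ (map (false ◂_) cs) h                            ≡⟨ cong₂ _+_ (∑-map h (true ◂_) cs) (∑-map h (false ◂_) cs) ⟩
    ∑ cs (h ∘ (true ◂_)) + ∑ cs (h ∘ (false ◂_))           ≡⟨ ∑-+ (h ∘ (true ◂_)) (h ∘ (false ◂_)) cs ⟨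
    ∑ cs (λ c → h (true ◂ c) + h (false ◂ c))              ∎
    where
    open ≡-Reasoning
    cs = colourings n

  sumTo-cong : ∀ n {f g : ℕ → ℕ} → (∀ i → i ≤ n → f i ≡ g i) → sumTo n f ≡ sumTo n g
  sumTo-cong zero    h = h 0 z≤n
  sumTo-cong (suc n) h = cong₂ _+_ (sumTo-cong n (λ i le → h i (m≤n⇒m≤1+n le))) (h (suc n) ≤-refl)

  sumTo-+ : ∀ n f g → sumTo n (λ i → f i + g i) ≡ sumTo n f + sumTo n g
  sumTo-+ zero    f g = refl
  sumTo-+ (suc n) f g = trans (cong (_+ (f (suc n) + g (suc n))) (sumTo-+ n f g))
    (+-interchange (sumTo n f) (sumTo n g) (f (suc n)) (g (suc n)))

  sumTo-shift : ∀ n f → sumTo (suc n) f ≡ f 0 + sumTo n (f ∘ suc)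
  sumTo-shift zero    f = refl
  sumTo-shift (suc n) f = trans (cong (_+ f (suc (suc n))) (sumTo-shift n f)) (+-assoc (f 0) _ _)

  -- Groups colourings by the size of one class. The first vertex increases either class, so the
  -- induction applies to `h′` and Pascal's rule recombines the two sums; hence the general `h`.
  ∑-colourings : ∀ n (h : ℕ → ℕ → ℕ) →
    ∑ (colourings n) (λ c → h (# c) (# (not ∘ c))) ≡ sumTo n (λ i → (n C i) * h i (n ∸ i))
  ∑-colourings zero    h = refl
  ∑-colourings (suc n) h = begin
    ∑ (colourings (suc n)) (λ c → h (# c) (# (not ∘ c)))   ≡⟨ ∑-colourings-suc n (λ c → h (# c) (# (not ∘ c))) ⟩
    ∑ (colourings n) (λ c → h′ (# c) (# (not ∘ c)))        ≡⟨ ∑-colourings n h′ ⟩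
    sumTo n (λ i → (n C i) * h′ i (n ∸ i))                   ≡⟨ sumTo-cong n (λ i le → expand i le) ⟩
    sumTo n (λ i → A i + B i)                              ≡⟨ sumTo-+ n A B ⟩
    sumTo n A + sumTo n B                                  ≡⟨ cong (_+ sumTo n B) (trans (sym (+-identityʳ _)) (cong (sumTo n A +_) (sym A-last))) ⟩
    sumTo (suc n) A + sumTo n B                            ≡⟨ cong (_+ sumTo n B) (sumTo-shift n A) ⟩
    A 0 + sumTo n (A ∘ suc) + sumTo n B                    ≡⟨ trans (+-assoc (A 0) _ _) (cong (A 0 +_) (trans (+-comm _ (sumTo n B)) (sym (sumTo-+ n B (A ∘ suc))))) ⟩
    A 0 + sumTo n (λ i → B i + A (suc i))                  ≡⟨ cong (A 0 +_) (sumTo-cong n (λ i _ → pascal i)) ⟩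
    A 0 + sumTo n (λ i → (suc n C suc i) * h (suc i) (n ∸ i)) ≡⟨ sumTo-shift n (λ i → (suc n C i) * h i (suc n ∸ i)) ⟨
    sumTo (suc n) (λ i → (suc n C i) * h i (suc n ∸ i))      ∎
    where
    open ≡-Reasoning
    h′ : ℕ → ℕ → ℕ
    h′ a b = h (suc a) b + h a (suc b)
    A B : ℕ → ℕ
    A i = (n C i) * h i (suc n ∸ i)
    B i = (n C i) * h (suc i) (n ∸ i)
    expand : ∀ i → i ≤ n → (n C i) * h′ i (n ∸ i) ≡ A i + B i
    expand i le = trans (*-distribˡ-+ (n C i) (h (suc i) (n ∸ i)) _)
      (trans (+-comm (B i) _) (cong (λ k → (n C i) * h i k + B i) (sym (+-∸-assoc 1 le))))
    -- This zero term extends the first sum by one, so that shifting its index aligns it with the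
    -- second.
    A-last : A (suc n) ≡ 0
    A-last = cong (_* h (suc n) (n ∸ n)) (k>n⇒nCk≡0 (n<1+n n))
    pascal : ∀ i → B i + A (suc i) ≡ (suc n C suc i) * h (suc i) (n ∸ i)
    pascal i = trans (sym (*-distribʳ-+ (h (suc i) (n ∸ i)) (n C i) (n C suc i)))
                     (cong (_* h (suc i) (n ∸ i)) (nCk+nC[k+1]≡[n+1]C[k+1] n i))

  F≡sumTo : ∀ n → F n ≡ sumTo n (λ i → (n C i) * 2 ^ (i * (n ∸ i)))
  F≡sumTo n = ∑-colourings n (λ a b → 2 ^ (a * b))

  -- Growth of `F`

  half≤ : ∀ a b {n} → a + b ≡ n → ⌈ n /2⌉ ≤ a ⊎ ⌈ n /2⌉ ≤ b
  half≤ a b refl with ≤-total a b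
  ... | inj₁ a≤b = inj₂ (≤-trans (⌈n/2⌉-mono (+-monoˡ-≤ b a≤b)) (≤-reflexive (sym (n≡⌈n+n/2⌉ b))))
  ... | inj₂ b≤a = inj₁ (≤-trans (⌈n/2⌉-mono (+-monoʳ-≤ a b≤a)) (≤-reflexive (sym (n≡⌈n+n/2⌉ a))))

  -- Give the new vertex the colour opposite to a class with at least half of the vertices: the
  -- number of possible edges grows by the size of that class.
  F-suc : ∀ n → 2 ^ ⌈ n /2⌉ * F n ≤ F (suc n)
  F-suc n = begin
    2 ^ ⌈ n /2⌉ * F n                                                        ≡⟨ ∑-*ˡ (2 ^ ⌈ n /2⌉) (λ c → 2 ^ edges c) (colourings n) ⟨
    ∑ (colourings n) (λ c → 2 ^ ⌈ n /2⌉ * 2 ^ edges c)                       ≤⟨ ∑-mono-≤ grow (colourings n) ⟩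
    ∑ (colourings n) (λ c → 2 ^ edges (true ◂ c) + 2 ^ edges (false ◂ c))    ≡⟨ ∑-colourings-suc n (λ c → 2 ^ edges c) ⟨
    F (suc n)                                                                ∎
    where
    open ≤-Reasoning
    grow : ∀ c → 2 ^ ⌈ n /2⌉ * 2 ^ edges c ≤ 2 ^ edges (true ◂ c) + 2 ^ edges (false ◂ c)
    grow c with half≤ (# c) (# (not ∘ c)) (#+#not≡n c)
    ... | inj₁ h = m≤n⇒m≤o+n (2 ^ edges (true ◂ c)) (≤-trans (≤-reflexive (sym (^-distribˡ-+-* 2 ⌈ n /2⌉ (edges c))))
           (^-monoʳ-≤ 2 (≤-trans (+-monoˡ-≤ (edges c) h) (≤-reflexive (sym (*-suc (# c) (# (not ∘ c))))))))
    ... | inj₂ h = m≤n⇒m≤n+o (2 ^ edges (false ◂ c)) (≤-trans (≤-reflexive (sym (^-distribˡ-+-* 2 ⌈ n /2⌉ (edges c))))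
           (^-monoʳ-≤ 2 (+-monoˡ-≤ (edges c) h)))

  F-suc-suc : ∀ n → 2 ^ suc n * F n ≤ F (2 + n)
  F-suc-suc n = begin
    -- `⌈ suc n /2⌉` unfolds to one more than the lower half of n, so the two exponents add up to n
    -- + 1.
    2 ^ suc n * F n                                  ≡⟨ cong (λ k → 2 ^ suc k * F n) (⌊n/2⌋+⌈n/2⌉≡n n) ⟨
    2 ^ (⌈ suc n /2⌉ + ⌈ n /2⌉) * F n                ≡⟨ cong (_* F n) (^-distribˡ-+-* 2 ⌈ suc n /2⌉ ⌈ n /2⌉) ⟩
    2 ^ ⌈ suc n /2⌉ * 2 ^ ⌈ n /2⌉ * F n              ≡⟨ *-assoc (2 ^ ⌈ suc n /2⌉) _ _ ⟩
    2 ^ ⌈ suc n /2⌉ * (2 ^ ⌈ n /2⌉ * F n)            ≤⟨ *-monoʳ-≤ (2 ^ ⌈ suc n /2⌉) (F-suc n) ⟩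
    2 ^ ⌈ suc n /2⌉ * F (suc n)                      ≤⟨ F-suc (suc n) ⟩
    F (2 + n)                                        ∎
    where open ≤-Reasoning

  -- Steps of two match (n + 2)² = n² + 4(n + 1) with the exponent n + 1 of `F-suc-suc`. The slack 1
  -- accounts for odd n.
  2^n²/4≤F : ∀ n → ∃[ t ] (n * n ≤ 4 * t + 1 × 2 ^ t ≤ F n)
  2^n²/4≤F zero          = 0 , z≤n , s≤s z≤n
  2^n²/4≤F (suc zero)    = 0 , s≤s z≤n , s≤s z≤n
  2^n²/4≤F (suc (suc n)) with t , h , k ← 2^n²/4≤F n =
    suc n + t , ≤-trans (≤-reflexive (square n)) (≤-trans (+-monoʳ-≤ (4 * suc n) h) (≤-reflexive (regroup n t))) , (begin
      2 ^ (suc n + t)       ≡⟨ ^-distribˡ-+-* 2 (suc n) t ⟩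
      2 ^ suc n * 2 ^ t     ≤⟨ *-monoʳ-≤ (2 ^ suc n) k ⟩
      2 ^ suc n * F n       ≤⟨ F-suc-suc n ⟩
      F (2 + n)             ∎)
    where
    open ≤-Reasoning
    square : ∀ n → (2 + n) * (2 + n) ≡ 4 * (1 + n) + n * n
    square = solve-∀
    regroup : ∀ n t → 4 * (1 + n) + (4 * t + 1) ≡ 4 * ((1 + n) + t) + 1
    regroup = solve-∀

  F≥1 : ∀ n → 1 ≤ F n
  F≥1 n = let t , _ , h = 2^n²/4≤F n in ≤-trans (m^n>0 2 t) h

  -- The gain 2^⌈n/2⌉ of `F-suc` beats a linear factor; squaring reduces this to a comparison with
  -- 2^n.
  isolated-≪ : ∀ K → Eventually (λ n → K * (suc n * (2 * F n)) ≤ F (suc n))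
  isolated-≪ K = ev-zip dominated (ev-≥ 1) (poly-≪-2^ (4 * K) 2)
    where
    open ≤-Reasoning
    dominated : ∀ n → 1 ≤ n → (4 * K * n) ^ 2 ≤ 2 ^ n → K * (suc n * (2 * F n)) ≤ F (suc n)
    dominated n 1≤n h = begin
      K * (suc n * (2 * F n))    ≤⟨ *-monoʳ-≤ K (*-monoˡ-≤ (2 * F n) (+-monoˡ-≤ n 1≤n)) ⟩
      K * ((n + n) * (2 * F n))  ≡⟨ rearrange K n (F n) ⟩
      4 * K * n * F n            ≤⟨ *-monoˡ-≤ (F n) (^-cancelˡ-≤ 2 {4 * K * n} {2 ^ ⌈ n /2⌉} (≤-trans h 2^n≤)) ⟩
      2 ^ ⌈ n /2⌉ * F n          ≤⟨ F-suc n ⟩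
      F (suc n)                  ∎
      where
      rearrange : ∀ K n f → K * ((n + n) * (2 * f)) ≡ 4 * K * n * f
      rearrange = solve-∀
      2^n≤ : 2 ^ n ≤ (2 ^ ⌈ n /2⌉) ^ 2
      2^n≤ = ≤-trans (^-monoʳ-≤ 2 (≤-trans (≤-reflexive (sym (⌊n/2⌋+⌈n/2⌉≡n n)))
               (≤-trans (+-monoˡ-≤ ⌈ n /2⌉ (⌊n/2⌋≤⌈n/2⌉ n)) (≤-reflexive (double ⌈ n /2⌉)))))
               (≤-reflexive (sym (^-*-assoc 2 ⌈ n /2⌉ 2)))
        where
        double : ∀ k → k + k ≡ k * 2
        double = solve-∀

  -- The covers compared with `F`

  length-colourings : ∀ n → length (colourings n) ≡ 2 ^ n
  length-colourings n = trans (length-choices n (λ _ → true) (λ _ → refl)) (cong (2 ^_) (#-true n))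

  -- Multiplied by 2^n, the claim follows colouring by colouring: there are 2^n of them, and each
  -- unbalanced one contributes far less than 2^(n²/4).
  crude-≪-F : (length ∘ crude) ≪ F
  crude-≪-F K = ev-map dominated (crude-dominated 100 25 (≤ᵇ⇒≤ 25 100 _) K)
    where
    open ≤-Reasoning
    dominated : ∀ n → (∀ m t → 100 * m + n * n ≤ 25 * (n * n) → 25 * (n * n) ≤ 100 * t + 25 →
      2 ^ m * (K * (2 ^ n * suc (n + n) ^ n)) ≤ 2 ^ t) → K * length (crude n) ≤ F n
    dominated n h with t , n²≤ , 2^t≤ ← 2^n²/4≤F n = *-cancelˡ-≤ (2 ^ n) {{m^n≢0 2 n}} (begin
      2 ^ n * (K * length (crude n))                                ≡⟨ *-assoc (2 ^ n) K _ ⟨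
      2 ^ n * K * length (crude n)                                  ≡⟨ cong (2 ^ n * K *_) (length-concatMap crudeOf (colourings n)) ⟩
      2 ^ n * K * ∑ (colourings n) (length ∘ crudeOf)               ≡⟨ ∑-*ˡ (2 ^ n * K) (length ∘ crudeOf) (colourings n) ⟨
      ∑ (colourings n) (λ c → 2 ^ n * K * length (crudeOf c))       ≤⟨ ∑-const-≤ each (colourings n) ⟩
      length (colourings n) * F n                                   ≡⟨ cong (_* F n) (length-colourings n) ⟩
      2 ^ n * F n                                                   ∎)
      where
      25n²≤ : 25 * (n * n) ≤ 100 * t + 25
      25n²≤ = ≤-trans (*-monoʳ-≤ 25 n²≤) (≤-reflexive (trans (*-distribˡ-+ 25 (4 * t) 1) (cong (_+ 25) (sym (*-assoc 25 4 t)))))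
      each : ∀ c → 2 ^ n * K * length (crudeOf c) ≤ F n
      each c with unbalanced c in e
      ... | false = ≤-trans (≤-reflexive (*-zeroʳ (2 ^ n * K))) z≤n
      ... | true  = begin
        2 ^ n * K * length (crudeCodes c)                       ≤⟨ *-monoʳ-≤ (2 ^ n * K) (length-crudeCodes c) ⟩
        2 ^ n * K * (2 ^ edges c * suc (n + n) ^ n)             ≡⟨ rearrange (2 ^ n) K (2 ^ edges c) (suc (n + n) ^ n) ⟩
        2 ^ edges c * (K * (2 ^ n * suc (n + n) ^ n))           ≤⟨ h (edges c) t (≤ᵇ⇒≤ (100 * edges c + n * n) (25 * (n * n)) (≡true⇒T e)) 25n²≤ ⟩
        2 ^ t                                                   ≤⟨ 2^t≤ ⟩
        F n                                                     ∎
        where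
        rearrange : ∀ a k b c → a * k * (b * c) ≡ b * (k * (a * c))
        rearrange = solve-∀

  -- A bound for the number of codes per smaller structure: the parameters times three options for
  -- each of at most 3(2 + n)/5 vertices of the other colour.
  pairFactor : ℕ → ℕ
  pairFactor n = paramCount n * 3 ^ (3 * (2 + n) / 5)

  paramCount≤ : ∀ n → paramCount n ≤ (2 * (2 + n)) ^ 4
  paramCount≤ n = ≤-trans
    (*-monoʳ-≤ (2 + n) (*-mono-≤ (n≤1+n (1 + n)) (*-monoʳ-≤ 2 (*-mono-≤ le (*-monoˡ-≤ 2 le)))))
    (≤-reflexive (rearrange (2 + n)))
    where
    le : suc (n + n) ≤ (2 + n) + (2 + n)
    le = s≤s (m≤n⇒m≤1+n (+-monoʳ-≤ n (m≤n+m n 2)))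
    rearrange : ∀ m → m * (m * (2 * ((m + m) * ((m + m) * 2)))) ≡ (2 * m) * ((2 * m) * ((2 * m) * ((2 * m) * 1)))
    rearrange = solve-∀

  pair-≪ : ∀ K → Eventually (λ n → K * (F n * pairFactor n) ≤ F (2 + n))
  pair-≪ K = ev-map dominated (ev-suc 2 (pair-dominated 24 3^≤2^ K))
    where
    open ≤-Reasoning
    rearrange : ∀ k f p → k * (f * p) ≡ k * p * f
    rearrange = solve-∀
    dominated : ∀ n → (∀ q t → q ≤ (2 * (2 + n)) ^ 4 → 5 * t ≤ 3 * (2 + n) → 2 * (K * (q * 3 ^ t)) ≤ 2 ^ (2 + n)) →
                K * (F n * pairFactor n) ≤ F (2 + n)
    dominated n h = begin
      K * (F n * pairFactor n)  ≡⟨ rearrange K (F n) (pairFactor n) ⟩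
      K * pairFactor n * F n    ≤⟨ *-monoˡ-≤ (F n) (*-cancelˡ-≤ {K * pairFactor n} {2 ^ suc n} 2 (h (paramCount n) t (paramCount≤ n) 5t≤)) ⟩
      2 ^ suc n * F n           ≤⟨ F-suc-suc n ⟩
      F (2 + n)                 ∎
      where
      t = 3 * (2 + n) / 5
      5t≤ : 5 * t ≤ 3 * (2 + n)
      5t≤ = ≤-trans (≤-reflexive (*-comm 5 t)) (m/n*n≤m (3 * (2 + n)) 5)

  length-tallCover : ∀ n → length (tallCover (2 + n)) ≤ length (crude (2 + n)) + length (cover n) * pairFactor n
  length-tallCover n = ≤-trans (≤-reflexive (length-++ (crude (2 + n)))) (+-monoʳ-≤ (length (crude (2 + n)))
    (≤-trans (length-pairCodes (3 * (2 + n) / 5) small (cover n))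
      (≤-reflexive (cong (λ k → length (cover n) * (k * 3 ^ (3 * (2 + n) / 5))) (length-params n)))))
    where
    small : ∀ k → 5 * k ≤ 3 * (2 + n) → k ≤ 3 * (2 + n) / 5
    small k h = ≤-trans (≤-reflexive (sym (m*n/n≡m k 5))) (/-monoˡ-≤ 5 (≤-trans (≤-reflexive (*-comm k 5)) h))

  length-cover≤ : ∀ n → length (cover n) ≤ 3 * F n + length (tallCover n)
  length-cover≤ n = ≤-trans (≤-reflexive (length-++ (base n))) (+-monoˡ-≤ (length (tallCover n)) (length-base n))

  tallCover-≪-F : (length ∘ tallCover) ≪ F
  tallCover-≪-F = remainder-≪ F≥1 length-cover≤ length-tallCover crude-≪-F pair-≪

-- Passage to rational numbers

open import Data.Nat using (ℕ; _!)
open import Data.Rational using (_*_)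
open import Data.Product using (_×_)
open import Data.Nat as ℕ using (zero; suc; z≤n)
import Data.Nat.Properties as ℕₚ
import Data.Nat.DivMod as ℕₚ
open import Data.Nat.Combinatorics using (_C_; nCk≡n!/k![n-k]!; k![n∸k]!∣n!)
open import Data.Integer as ℤ using (+_; +[1+_])
import Data.Integer.Properties as ℤₚ
open import Data.Rational using (ℚ; mkℚ; _+_; _-_; _/_; _≤_; ∣_∣; toℚᵘ; Positive; positive)
open import Data.Rational.Properties
open import Data.Rational.Unnormalised as ℚᵘ using (mkℚᵘ; *≡*; *≤*)
import Data.Rational.Unnormalised.Properties as ℚᵘₚ
open import Algebra.Properties.AbelianGroup +-0-abelianGroup using (⁻¹-anti-homo‿-; xyx⁻¹≈y)
open import Data.List using (length)
open import Data.List.Relation.Unary.All as All using (All)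
open import Data.Product using (∃-syntax; _,_)
open import Data.Sum using (inj₁; inj₂)
open import Function using (_∘_)
open import Function.Bundles using (Equivalence)
open import Relation.Binary.PropositionalEquality

-- `_/_` reduces to lowest terms; this returns to the unreduced fraction, where identities are
-- checked by cross multiplication.
toℚᵘ-/ : ∀ p d → toℚᵘ (p / suc d) ℚᵘ.≃ mkℚᵘ p d
toℚᵘ-/ p d = toℚᵘ-fromℚᵘ (mkℚᵘ p d)

fromℕℚ-+ : ∀ m n → fromℕℚ (m ℕ.+ n) ≡ fromℕℚ m + fromℕℚ n
fromℕℚ-+ m n = toℚᵘ-injective (begin
  toℚᵘ (fromℕℚ (m ℕ.+ n))                       ≈⟨ toℚᵘ-/ (+ (m ℕ.+ n)) 0 ⟩
  mkℚᵘ (+ (m ℕ.+ n)) 0                          ≈⟨ *≡* (cong (ℤ._* + 1) (cong₂ ℤ._+_ (sym (ℤₚ.*-identityʳ (+ m))) (sym (ℤₚ.*-identityʳ (+ n))))) ⟩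
  mkℚᵘ (+ m) 0 ℚᵘ.+ mkℚᵘ (+ n) 0                ≈⟨ ℚᵘₚ.+-cong (toℚᵘ-/ (+ m) 0) (toℚᵘ-/ (+ n) 0) ⟨
  toℚᵘ (fromℕℚ m) ℚᵘ.+ toℚᵘ (fromℕℚ n)          ≈⟨ toℚᵘ-homo-+ (fromℕℚ m) (fromℕℚ n) ⟨
  toℚᵘ (fromℕℚ m + fromℕℚ n)                    ∎)
  where open ℚᵘₚ.≃-Reasoning

fromℕℚ-*-/ : ∀ k x d .{{_ : ℕ.NonZero d}} → fromℕℚ (k ℕ.* d) * ((+ x) / d) ≡ fromℕℚ (k ℕ.* x)
fromℕℚ-*-/ k x d@(suc d-1) = toℚᵘ-injective (begin
  toℚᵘ (fromℕℚ (k ℕ.* d) * ((+ x) / d))                 ≈⟨ toℚᵘ-homo-* (fromℕℚ (k ℕ.* d)) ((+ x) / d) ⟩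
  toℚᵘ (fromℕℚ (k ℕ.* d)) ℚᵘ.* toℚᵘ ((+ x) / d)         ≈⟨ ℚᵘₚ.*-cong (toℚᵘ-/ (+ (k ℕ.* d)) 0) (toℚᵘ-/ (+ x) d-1) ⟩
  mkℚᵘ (+ (k ℕ.* d)) 0 ℚᵘ.* mkℚᵘ (+ x) d-1              ≈⟨ *≡* (trans (ℤₚ.*-identityʳ _) cross) ⟩
  mkℚᵘ (+ (k ℕ.* x)) 0                                  ≈⟨ toℚᵘ-/ (+ (k ℕ.* x)) 0 ⟨
  toℚᵘ (fromℕℚ (k ℕ.* x))                               ∎)
  where
  open ℚᵘₚ.≃-Reasoning
  cross : (+ (k ℕ.* d)) ℤ.* (+ x) ≡ (+ (k ℕ.* x)) ℤ.* (+ (1 ℕ.* d))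
  cross = trans (sym (ℤₚ.pos-* (k ℕ.* d) x)) (trans (cong +_ nat) (ℤₚ.pos-* (k ℕ.* x) (1 ℕ.* d)))
    where
    nat : k ℕ.* d ℕ.* x ≡ k ℕ.* x ℕ.* (1 ℕ.* d)
    nat = trans (ℕₚ.*-assoc k d x) (trans (cong (k ℕ.*_) (ℕₚ.*-comm d x))
      (trans (sym (ℕₚ.*-assoc k x d)) (cong (k ℕ.* x ℕ.*_) (sym (ℕₚ.*-identityˡ d)))))

fromℕℚ-mono : ∀ {m n} → m ℕ.≤ n → fromℕℚ m ≤ fromℕℚ n
fromℕℚ-mono {m} {n} h = toℚᵘ-cancel-≤ (ℚᵘₚ.≤-respˡ-≃ (ℚᵘₚ.≃-sym (toℚᵘ-/ (+ m) 0)) (ℚᵘₚ.≤-respʳ-≃ (ℚᵘₚ.≃-sym (toℚᵘ-/ (+ n) 0))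
  (*≤* (ℤₚ.*-monoʳ-≤-nonNeg (+ 1) (ℤ.+≤+ h)))))

∣fromℕℚ∣ : ∀ n → ∣ fromℕℚ n ∣ ≡ fromℕℚ n
∣fromℕℚ∣ n = 0≤p⇒∣p∣≡p (fromℕℚ-mono {0} {n} z≤n)

∣-∣-comm : ∀ p q → ∣ p - q ∣ ≡ ∣ q - p ∣
∣-∣-comm p q = trans (cong ∣_∣ (sym (⁻¹-anti-homo‿- q p))) (∣-p∣≡∣p∣ (q - p))

∣fromℕℚ-fromℕℚ∣-≥ : ∀ {a b} → b ℕ.≤ a → ∣ fromℕℚ a - fromℕℚ b ∣ ≡ fromℕℚ ℕ.∣ a - b ∣
∣fromℕℚ-fromℕℚ∣-≥ {a} {b} b≤a = begin
  ∣ fromℕℚ a - fromℕℚ b ∣                             ≡⟨ cong (λ k → ∣ fromℕℚ k - fromℕℚ b ∣) (ℕₚ.m+[n∸m]≡n b≤a) ⟨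
  ∣ fromℕℚ (b ℕ.+ (a ℕ.∸ b)) - fromℕℚ b ∣             ≡⟨ cong (λ z → ∣ z - fromℕℚ b ∣) (fromℕℚ-+ b (a ℕ.∸ b)) ⟩
  ∣ (fromℕℚ b + fromℕℚ (a ℕ.∸ b)) - fromℕℚ b ∣        ≡⟨ cong ∣_∣ (xyx⁻¹≈y (fromℕℚ b) (fromℕℚ (a ℕ.∸ b))) ⟩
  ∣ fromℕℚ (a ℕ.∸ b) ∣                                ≡⟨ ∣fromℕℚ∣ (a ℕ.∸ b) ⟩
  fromℕℚ (a ℕ.∸ b)                                    ≡⟨ cong fromℕℚ (trans (ℕₚ.∣-∣-comm a b) (ℕₚ.m≤n⇒∣m-n∣≡n∸m b≤a)) ⟨
  fromℕℚ ℕ.∣ a - b ∣                                  ∎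
  where open ≡-Reasoning

∣fromℕℚ-fromℕℚ∣ : ∀ a b → ∣ fromℕℚ a - fromℕℚ b ∣ ≡ fromℕℚ ℕ.∣ a - b ∣
∣fromℕℚ-fromℕℚ∣ a b with ℕₚ.≤-total a b
... | inj₁ a≤b = trans (∣-∣-comm (fromℕℚ a) (fromℕℚ b)) (trans (∣fromℕℚ-fromℕℚ∣-≥ a≤b) (cong fromℕℚ (ℕₚ.∣-∣-comm b a)))
... | inj₂ b≤a = ∣fromℕℚ-fromℕℚ∣-≥ b≤a

fromℕℚ-∼ : ∀ a b → a ∼ℕ b → (fromℕℚ ∘ a) ∼ (fromℕℚ ∘ b)
fromℕℚ-∼ a b a∼b ε 0<ε = small ε (positive 0<ε)
  where
  small : ∀ ε → Positive ε → ∃[ N ] ∀ n → N ℕ.≤ n → ∣ fromℕℚ (a n) - fromℕℚ (b n) ∣ ≤ ε * ∣ fromℕℚ (b n) ∣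
  -- As ε = (p + 1)/(d + 1) is at least 1/(d + 1), the constant K = d + 1 suffices.
  small ε@(mkℚ +[1+ p ] d _) ε>0 with N , h ← a∼b (suc d) = N , λ n N≤n → bound (a n) (b n) (h n N≤n)
    where
    open ≤-Reasoning
    instance _ = pos⇒nonNeg ε {{ε>0}}
    bound : ∀ x y → suc d ℕ.* ℕ.∣ x - y ∣ ℕ.≤ y → ∣ fromℕℚ x - fromℕℚ y ∣ ≤ ε * ∣ fromℕℚ y ∣
    bound x y le = begin
      ∣ fromℕℚ x - fromℕℚ y ∣             ≡⟨ ∣fromℕℚ-fromℕℚ∣ x y ⟩
      fromℕℚ D                            ≤⟨ fromℕℚ-mono (ℕₚ.m≤m*n D (suc p)) ⟩
      fromℕℚ (D ℕ.* suc p)                ≡⟨ fromℕℚ-*-/ D (suc p) (suc d) ⟨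
      fromℕℚ (D ℕ.* suc d) * (+[1+ p ] / suc d) ≡⟨ cong (λ z → fromℕℚ (D ℕ.* suc d) * z) (↥p/↧p≡p ε) ⟩
      fromℕℚ (D ℕ.* suc d) * ε            ≡⟨ *-comm (fromℕℚ (D ℕ.* suc d)) ε ⟩
      ε * fromℕℚ (D ℕ.* suc d)            ≤⟨ *-monoˡ-≤-nonNeg ε (fromℕℚ-mono (ℕₚ.≤-trans (ℕₚ.≤-reflexive (ℕₚ.*-comm D (suc d))) le)) ⟩
      ε * fromℕℚ y                        ≡⟨ cong (λ z → ε * z) (∣fromℕℚ∣ y) ⟨
      ε * ∣ fromℕℚ y ∣                    ∎
      where D = ℕ.∣ x - y ∣

∼-respʳ : ∀ (a b b′ : ℕ → ℚ) → (∀ n → b n ≡ b′ n) → a ∼ b → a ∼ b′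
∼-respʳ a b b′ e h ε 0<ε = let N , k = h ε 0<ε in
  N , λ n le → subst (λ z → ∣ a n - z ∣ ≤ ε * ∣ z ∣) (e n) (k n le)

Σ≤-cong : ∀ m {f g : ℕ → ℚ} → (∀ i → i ℕ.≤ m → f i ≡ g i) → Σ≤ m f ≡ Σ≤ m g
Σ≤-cong zero    h = h 0 z≤n
Σ≤-cong (suc m) h = cong₂ _+_ (Σ≤-cong m (λ i le → h i (ℕₚ.m≤n⇒m≤1+n le))) (h (suc m) ℕₚ.≤-refl)

Σ≤-*ˡ : ∀ m c f → Σ≤ m (λ i → c * f i) ≡ c * Σ≤ m f
Σ≤-*ˡ zero    c f = refl
Σ≤-*ˡ (suc m) c f = trans (cong (λ z → z + c * f (suc m)) (Σ≤-*ˡ m c f)) (sym (*-distribˡ-+ c (Σ≤ m f) (f (suc m))))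

fromℕℚ-sumTo : ∀ m f → fromℕℚ (sumTo m f) ≡ Σ≤ m (fromℕℚ ∘ f)
fromℕℚ-sumTo zero    f = refl
fromℕℚ-sumTo (suc m) f = trans (fromℕℚ-+ (sumTo m f) (f (suc m))) (cong (λ z → z + fromℕℚ (f (suc m))) (fromℕℚ-sumTo m f))

-- n!/(i!(n - i)!) is the binomial coefficient, so n! clears the denominator of each term exactly.
ψterm-nC : ∀ n i → i ℕ.≤ n → fromℕℚ (n !) * ψterm n i ≡ fromℕℚ ((n C i) ℕ.* 2 ℕ.^ (i ℕ.* (n ℕ.∸ i)))
ψterm-nC n i i≤n = trans (cong (λ k → fromℕℚ k * ψterm n i) n!≡)
  (fromℕℚ-*-/ (n C i) (2 ℕ.^ (i ℕ.* (n ℕ.∸ i))) (i ! ℕ.* (n ℕ.∸ i) !))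
  where
  instance _ = i ℕₚ.!* (n ℕ.∸ i) !≢0
  n!≡ : n ! ≡ (n C i) ℕ.* (i ! ℕ.* (n ℕ.∸ i) !)
  n!≡ = sym (trans (cong (ℕ._* (i ! ℕ.* (n ℕ.∸ i) !)) (nCk≡n!/k![n-k]! i≤n)) (ℕₚ.m/n*n≡m (k![n∸k]!∣n! i≤n)))

n!ψ≡F : ∀ n → fromℕℚ (F n) ≡ fromℕℚ (n !) * ψ n
n!ψ≡F n = begin
  fromℕℚ (F n)                                                          ≡⟨ cong fromℕℚ (F≡sumTo n) ⟩
  fromℕℚ (sumTo n (λ i → (n C i) ℕ.* 2 ℕ.^ (i ℕ.* (n ℕ.∸ i))))          ≡⟨ fromℕℚ-sumTo n (λ i → (n C i) ℕ.* 2 ℕ.^ (i ℕ.* (n ℕ.∸ i))) ⟩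
  Σ≤ n (λ i → fromℕℚ ((n C i) ℕ.* 2 ℕ.^ (i ℕ.* (n ℕ.∸ i))))             ≡⟨ Σ≤-cong n (ψterm-nC n) ⟨
  Σ≤ n (λ i → fromℕℚ (n !) * ψterm n i)                                 ≡⟨ Σ≤-*ˡ n (fromℕℚ (n !)) (ψterm n) ⟩
  fromℕℚ (n !) * ψ n                                                    ∎
  where open ≡-Reasoning

-- Forgetting the conditions on extremal elements places each entry of the strong list in the weak
-- one; equality serves as the coding relation.
strong≤weak : ∀ {n k l} → StrongCount n k → WeakCount n l → k ℕ.≤ l
strong≤weak (xs , uniq , iff , refl) (ys , _ , iff′ , refl) =
  distinct-codes⇒length≤ {_~_ = _≡_} _≡_ (λ p q → trans p (sym q)) uniq
    (All.tabulate λ {R} R∈ → let poset , (rk , isRank , _) , avoids = Equivalence.from (iff R) R∈ in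
      Equivalence.to (iff′ R) (poset , (rk , isRank) , avoids))

weak≤F+tall : ∀ {n k} → WeakCount n k → k ℕ.≤ F n ℕ.+ length (tallCover n)
weak≤F+tall (xs , uniq , iff , refl) = count≤ uniq
  (All.tabulate λ {R} R∈ → let poset , _ , avoids = Equivalence.from (iff R) R∈ in poset , avoids)

F≤strong+isolated : ∀ {n k} → StrongCount (suc n) k → F (suc n) ℕ.≤ k ℕ.+ suc n ℕ.* (2 ℕ.* F n)
F≤strong+isolated {n} (xs , _ , iff , refl) = bips≤count n xs (λ R → Equivalence.to (iff R))

-- The value at 0 is a placeholder: the lower bound is used from n = 1 on.
isolatedBound : ℕ → ℕ
isolatedBound zero    = 0
isolatedBound (suc n) = suc n ℕ.* (2 ℕ.* F n)

theorem9p2 : (g w : ℕ → ℕ)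
    → (∀ n → StrongCount n (g n))
    → (∀ n → WeakCount n (w n))
    → ((λ n → fromℕℚ (g n)) ∼ (λ n → fromℕℚ (w n)))
    × ((λ n → fromℕℚ (w n)) ∼ (λ n → fromℕℚ (n !) * ψ n))
    × ((λ n → fromℕℚ (g n)) ∼ (λ n → fromℕℚ (n !) * ψ n))
theorem9p2 g w strong weak =
  let g∼w , w∼F , g∼F = squeeze {e = isolatedBound} {length ∘ tallCover}
        (ev-pred 1 (0 , λ n _ → F≤strong+isolated (strong (suc n))))
        (λ n → strong≤weak (strong n) (weak n)) (λ n → weak≤F+tall (weak n))
        (λ K → ev-pred 1 (isolated-≪ K)) tallCover-≪-F
  in fromℕℚ-∼ g w g∼w
   , ∼-respʳ (fromℕℚ ∘ w) (fromℕℚ ∘ F) (λ n → fromℕℚ (n !) * ψ n) n!ψ≡F (fromℕℚ-∼ w F w∼F)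
   , ∼-respʳ (fromℕℚ ∘ g) (fromℕℚ ∘ F) (λ n → fromℕℚ (n !) * ψ n) n!ψ≡F (fromℕℚ-∼ g F g∼F)
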